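{- Any single-pass streaming algorithm that, for every $n$-vertex graph $G$, outputs the exact value $\mathrm{OPT}(G)$ with probability at least $2/3$ uses $\Omega(n^2)$ bits of memory, even with unbounded computation time.
   Context: For a graph $G=(V,E)$ (unit edge weights), a hierarchical clustering tree (HC-tree) is a rooted tree whose leaves are in bijection with $V$; its cost is $C_G(\mathcal T)=\sum_{(u,v)\in E}|\mathrm{leaves}(\mathcal T[u\vee v])|$, with $u\vee v$ the lowest common ancestor and $\mathrm{leaves}(\mathcal T[z])$ the leaf set of the subtree rooted at $z$; $\mathrm{OPT}(G)$ is the minimum cost over HC-trees. Streaming model: edges arrive one at a time in an arbitrary order; a single-pass algorithm reads them once; memory is the maximum number of bits stored. -}

module Defs where

open import Data.Bool using (Bool)
open import Data.Fin using (Fin; _<_)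
open import Data.Fin.Properties using (_≟_; any?)
open import Data.Fin.Subset using (Subset; _∈_; ∣_∣)
open import Data.List using (List; []; _∷_; allFin; concat; length; map; tabulate)
import Data.List.Membership.DecPropositional as DecMembership
open import Data.List.Relation.Binary.Permutation.Propositional using (_↭_)
open import Data.List.Relation.Unary.Unique.Propositional using (Unique)
open import Data.Nat using (ℕ; zero; suc; _*_; _≤_; NonZero)
open import Data.Nat.ListAction using (sum)
open import Data.Product using (∃; _×_; _,_)
open import Relation.Binary.PropositionalEquality using (_≡_)
open import Relation.Nullary using (yes; no)
open import Relation.Nullary.Decidable using (_×-dec_)

private
  module Mem {n : ℕ} = DecMembership (_≟_ {n})

IsMin : (ℕ → Set) → ℕ → Set
IsMin P m = P m × (∀ k → P k → m ≤ k)

IsMax : (ℕ → Set) → ℕ → Set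
IsMax P m = P m × (∀ k → P k → k ≤ m)

-- An unordered pair of distinct vertices, encoded with its smaller end first,
-- so that propositional equality of edges is equality of unordered pairs.
record Edge (n : ℕ) : Set where
  constructor edge
  field
    src tgt : Fin n
    src<tgt : src < tgt

-- A simple graph on Fin n.  The edge set is a repetition-free list; nothing
-- below depends on the order in which this list happens to be written.
record Graph (n : ℕ) : Set where
  field
    edges        : List (Edge n)
    edges-unique : Unique edges

-- The arity suc k keeps internal nodes from being unlabelled leaves; it is
-- otherwise unrestricted (trees need not be binary).
data Tree (n : ℕ) : Set where
  leaf : Fin n → Tree n
  node : ∀ {k} → (Fin (suc k) → Tree n) → Tree n

leaves : ∀ {n} → Tree n → List (Fin n)
leaves (leaf v) = v ∷ []
leaves (node c) = concat (tabulate (λ i → leaves (c i)))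

-- The subtree rooted at the lowest common ancestor of u and v, provided both
-- occur in the tree: descend for as long as one child contains both.
lca : ∀ {n} → Tree n → Fin n → Fin n → Tree n
lca (leaf w) u v = leaf w
lca (node c) u v
  with any? (λ i → (u Mem.∈? leaves (c i)) ×-dec (v Mem.∈? leaves (c i)))
... | yes (i , _) = lca (c i) u v
... | no  _       = node c

record HCTree (n : ℕ) : Set where
  field
    tree            : Tree n
    leaves-biject-V : leaves tree ↭ allFin n

cost : ∀ {n} → Graph n → HCTree n → ℕ
cost G T = sum (map edgeCost (Graph.edges G))
  where
  edgeCost : Edge _ → ℕ
  edgeCost (edge u v _) = length (leaves (lca (HCTree.tree T) u v))

IsOPT : ∀ {n} → Graph n → ℕ → Set
IsOPT G = IsMin (λ c → ∃ λ T → cost G T ≡ c)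

IsStreamOf : ∀ {n} → List (Edge n) → Graph n → Set
IsStreamOf σ G = σ ↭ Graph.edges G

-- A randomized single-pass algorithm for graphs on the vertex set Fin n.  The
-- memory content is a bit string.  The coins are a uniformly random seed; the
-- seed and the number of edges read so far are available for free and not
-- charged to the memory, so fresh private coins at each step are a special
-- case.  The maps are arbitrary and may depend on n, i.e. computation is
-- unbounded (and the workspace used while handling one edge is not charged).
record StreamingAlgorithm (n : ℕ) : Set where
  field
    seeds  : ℕ
    ⦃ seeds-nonZero ⦄ : NonZero seeds
    init   : Fin seeds → List Bool
    step   : Fin seeds → ℕ → Edge n → List Bool → List Bool
    output : Fin seeds → ℕ → List Bool → ℕ

  runFrom : Fin seeds → ℕ → List Bool → List (Edge n) → List Bool
  runFrom ω t s []      = s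
  runFrom ω t s (e ∷ σ) = runFrom ω (suc t) (step ω t e s) σ

  memoryAfter : Fin seeds → List (Edge n) → List Bool
  memoryAfter ω σ = runFrom ω 0 (init ω) σ

  result : Fin seeds → List (Edge n) → ℕ
  result ω σ = output ω (length σ) (memoryAfter ω σ)

-- Pr[ P ] ≥ 2/3 for the uniform distribution on Fin r: the event P contains a
-- set of at least 2r/3 outcomes.  For decidable P this is the usual count.
Pr≥2/3 : ∀ {r} → (Fin r → Set) → Set
Pr≥2/3 {r} P = ∃ λ (S : Subset r) → (∀ ω → ω ∈ S → P ω) × 2 * r ≤ 3 * ∣ S ∣

ComputesOPT : ∀ {n} → StreamingAlgorithm n → Set
ComputesOPT {n} A =
  (G : Graph n) (σ : List (Edge n)) → IsStreamOf σ G →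
  Pr≥2/3 (λ ω → IsOPT G (StreamingAlgorithm.result A ω σ))

-- The maximum number of bits stored, over all inputs, seeds and times.  Only
-- complete streams are mentioned because every prefix of a stream is itself
-- the complete stream of a subgraph.
IsMemory : ∀ {n} → StreamingAlgorithm n → ℕ → Set
IsMemory {n} A = IsMax λ b →
  ∃ λ (G : Graph n) → ∃ λ σ → ∃ λ ω →
  IsStreamOf σ G × length (StreamingAlgorithm.memoryAfter A ω σ) ≡ b

{-# OPTIONS --safe #-}

-- Let H be the complement of G.  Summed over ordered pairs, 2 cost(T) + n + Σ_H |leaves(u ∨ v)| is the number of triples
-- (u, v, z) with z below u ∨ v, and of u ∨ v, u ∨ z, v ∨ z at least two lie above the third vertex (exactly two in a binary
-- tree, unless u = v = z).  Hence 6 cost(T) + 3n + 3n |H| ≥ 2n³ + n + 3 loss(U) for a root split U of T, where loss(U) counts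
-- the triples with uv ∈ H, U u = U v ≠ U z; equality holds for some binary T when the H-edges inside each part form a star.
--
-- Alice encodes k² bits in a k-regular bipartite H between two sets of 2k vertices.  To query the pair (u₀, v₀), Bob adds two
-- large classes of pads, joined in H completely to each other and each to one side of Alice's bipartition with u₀ and v₀
-- exchanged.  Every other cut loses too much, and this one loses 2n(k − [u₀v₀ ∈ H]), so OPT reveals the bit, and the memory
-- after Alice's edges is a one-way message for INDEX on k² = Ω(n²) bits.
--
-- For INDEX, a fixed guess y ∈ {0,1}^N satisfies Σ_x 2^agreement(x,y) = 3^N, while a success rate of 2/3 forces the sum over
-- the guesses made from the messages to be at least 2^(N + 2N/3); so there are at least (32/27)^(N/3) messages.
module Submission where

-- On the complete graph all binary trees cost the same, so only the missing edges, the pairs of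
-- `H`, tell trees apart: a pair of `H` is best joined high, and the root split is what the pads can
-- force. With Alice's own bipartition as the root split, all her pairs of `H` would cross and the
-- loss would be 0 for every input. Exchanging `u₀` and `v₀` moves the pairs of `H` at these two
-- vertices inside the parts, except the pair of `u₀` and `v₀` itself, which still crosses. Each
-- part then holds a star, and a caterpillar headed by its hub joins the whole star at the top of
-- the part. Regularity hides all other bits: the loss, the size of `H` and the number of Alice's
-- edges do not depend on them, and Bob needs the last two to resume the run and to decode. Trees
-- may have any arity, unary nodes included. The lower bound therefore cuts at the first branching
-- node, first child against the rest, and works with inequalities only. Quantities such as `k`
-- minus the bit appear in additive form, which keeps everything in the natural numbers.

open import Defs
open import Data.Bool using (Bool; true; false; not; _∧_; _∨_; _xor_; T?)
open import Data.Bool.Properties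
  using (T-≡; ∧-zeroʳ; ∨-comm; ∨-identityʳ; xor-comm; xor-identityʳ; xor-same)
  renaming (_≟_ to _≟ᵇ_)
open import Data.Empty using (⊥; ⊥-elim)
open import Data.Fin using (Fin; zero; suc; _↑ˡ_; _↑ʳ_; combine; fromℕ<; remQuot; splitAt)
open import Data.Fin.Properties
  using (_≟_; 0≢1+n; all?; any?; combine-remQuot; splitAt-↑ˡ; splitAt-↑ʳ; splitAt⁻¹-↑ˡ; splitAt⁻¹-↑ʳ; suc-injective; ¬∀⟶∃¬)
open import Data.Fin.Subset using (Subset; ∣_∣) renaming (_∈_ to _∈ₛ_)
open import Data.List using (List; []; _∷_; [_]; _++_; allFin; concat; filter; length; map; tabulate)
import Data.List.Membership.DecPropositional as DecMembership
open import Data.List.Membership.Propositional using (_∈_)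
open import Data.List.Membership.Propositional.Properties
  using (∈-allFin; ∈-concat⁺′; ∈-concat⁻′; ∈-filter⁺; ∈-filter⁻; ∈-map⁻; ∈-tabulate⁺; ∈-tabulate⁻; ∈-∃++)
open import Data.List.Properties using (++-identityʳ; length-++; map-++; map-tabulate; map-∘)
open import Data.List.Relation.Binary.Disjoint.Propositional using (Disjoint)
open import Data.List.Relation.Binary.Permutation.Propositional
  using (_↭_; ↭-prep; ↭-refl; ↭-reflexive; ↭-sym; ↭-trans; ↭⇒↭ₛ)
open import Data.List.Relation.Binary.Permutation.Propositional.Properties using (++⁺; shift; ∈-resp-↭)
import Data.List.Relation.Binary.Permutation.Setoid.Properties as Permutationₛ
import Data.List.Relation.Unary.All as All
import Data.List.Relation.Unary.All.Properties as Allₚ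
open import Data.List.Relation.Unary.AllPairs using ([]; _∷_)
open import Data.List.Relation.Unary.Any using (here; there)
open import Data.List.Relation.Unary.Unique.Propositional using (Unique)
import Data.List.Relation.Unary.Unique.Propositional.Properties as Uniqueₚ
open import Data.Nat
  using (ℕ; zero; suc; _+_; _*_; _^_; _/_; _%_; _≤_; _<_; _≤?_; z≤n; s≤s; s≤s⁻¹; NonZero)
open import Data.Nat.DivMod using (m%n<n; m≡m%n+[m/n]*n; m≥n⇒m/n>0)
open import Data.Nat.ListAction using (sum)
open import Data.Nat.ListAction.Properties using (sum-++)
open import Data.Nat.Properties hiding (_≟_; 0≢1+n; suc-injective)
open import Data.Nat.Properties using () renaming (_≟_ to _≟ℕ_)
open import Algebra.Properties.Semiring.Sum +-*-semiring
  using (*-distribˡ-sum; sum-cong-≗; ∑-comm; ∑-distrib-+)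
  renaming (sum to ∑)
open import Data.Nat.Tactic.RingSolver using (solve-∀)
open import Data.Product using (∃; ∃₂; _×_; _,_; proj₁; proj₂)
open import Data.Sum using (_⊎_; inj₁; inj₂; [_,_]′)
open import Data.Unit using (⊤; tt)
open import Data.Vec using (Vec; []; _∷_; here; lookup; replicate; there)
open import Function using (_∘_)
open import Function.Bundles using (Equivalence)
open import Relation.Binary.PropositionalEquality hiding ([_])
open import Relation.Nullary using (Dec; does; no; yes; ¬_; contradiction)
open import Relation.Nullary.Decidable using (dec-false; dec-true; _×-dec_)

-- Finite sums

ι : Bool → ℕ
ι true  = 1
ι false = 0

ι≤1 : ∀ b → ι b ≤ 1
ι≤1 true  = ≤-refl
ι≤1 false = z≤n

∑-mono : ∀ {n} {f g : Fin n → ℕ} → (∀ i → f i ≤ g i) → ∑ f ≤ ∑ g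
∑-mono {zero}  f≤g = z≤n
∑-mono {suc n} f≤g = +-mono-≤ (f≤g zero) (∑-mono (f≤g ∘ suc))

∑-mono-< : ∀ {n} .⦃ _ : NonZero n ⦄ {f g : Fin n → ℕ} → (∀ i → f i < g i) → ∑ f < ∑ g
∑-mono-< {suc n} f<g = +-mono-<-≤ (f<g zero) (∑-mono (<⇒≤ ∘ f<g ∘ suc))

∑-const : ∀ n c → ∑ {n} (λ _ → c) ≡ n * c
∑-const zero    c = refl
∑-const (suc n) c = cong (c +_) (∑-const n c)

*-distribˡ-∑ : ∀ {n} c (f : Fin n → ℕ) → ∑ (λ i → c * f i) ≡ c * ∑ f
*-distribˡ-∑ c f = sym (*-distribˡ-sum c f)

-- Sums over the cube and over short messages

∑ᵛ : ∀ N → (Vec Bool N → ℕ) → ℕ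
∑ᵛ zero    F = F []
∑ᵛ (suc N) F = ∑ᵛ N (F ∘ (false ∷_)) + ∑ᵛ N (F ∘ (true ∷_))

-- Ranges over all strings of length at most `m`: memory is a maximum, so its contents may also be
-- shorter.
∑ᵐ : ℕ → (List Bool → ℕ) → ℕ
∑ᵐ zero    F = F []
∑ᵐ (suc m) F = F [] + (∑ᵐ m (F ∘ (false ∷_)) + ∑ᵐ m (F ∘ (true ∷_)))

interchange : ∀ a b c d → (a + b) + (c + d) ≡ (a + c) + (b + d)
interchange = solve-∀

∑ᵛ-mono : ∀ N {F G : Vec Bool N → ℕ} → (∀ x → F x ≤ G x) → ∑ᵛ N F ≤ ∑ᵛ N G
∑ᵛ-mono zero    F≤G = F≤G []
∑ᵛ-mono (suc N) F≤G = +-mono-≤ (∑ᵛ-mono N (F≤G ∘ (false ∷_))) (∑ᵛ-mono N (F≤G ∘ (true ∷_)))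

∑ᵛ-cong : ∀ N {F G : Vec Bool N → ℕ} → (∀ x → F x ≡ G x) → ∑ᵛ N F ≡ ∑ᵛ N G
∑ᵛ-cong zero    F≡G = F≡G []
∑ᵛ-cong (suc N) F≡G = cong₂ _+_ (∑ᵛ-cong N (F≡G ∘ (false ∷_))) (∑ᵛ-cong N (F≡G ∘ (true ∷_)))

∑ᵛ-+ : ∀ N (F G : Vec Bool N → ℕ) → ∑ᵛ N (λ x → F x + G x) ≡ ∑ᵛ N F + ∑ᵛ N G
∑ᵛ-+ zero    F G = refl
∑ᵛ-+ (suc N) F G = trans
  (cong₂ _+_ (∑ᵛ-+ N (F ∘ (false ∷_)) (G ∘ (false ∷_))) (∑ᵛ-+ N (F ∘ (true ∷_)) (G ∘ (true ∷_))))
  (interchange (∑ᵛ N (F ∘ (false ∷_))) (∑ᵛ N (G ∘ (false ∷_))) _ _)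

∑ᵛ-* : ∀ N c (F : Vec Bool N → ℕ) → ∑ᵛ N (λ x → c * F x) ≡ c * ∑ᵛ N F
∑ᵛ-* zero    c F = refl
∑ᵛ-* (suc N) c F = trans
  (cong₂ _+_ (∑ᵛ-* N c (F ∘ (false ∷_))) (∑ᵛ-* N c (F ∘ (true ∷_))))
  (sym (*-distribˡ-+ c (∑ᵛ N (F ∘ (false ∷_))) _))

∑ᵛ-const : ∀ N c → ∑ᵛ N (λ _ → c) ≡ 2 ^ N * c
∑ᵛ-const zero    c = sym (+-identityʳ c)
∑ᵛ-const (suc N) c rewrite ∑ᵛ-const N c = double (2 ^ N) c
  where
  double : ∀ a c → a * c + a * c ≡ 2 * a * c
  double = solve-∀

∑-∑ᵛ-comm : ∀ r N (F : Fin r → Vec Bool N → ℕ) →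
            ∑ (λ ω → ∑ᵛ N (F ω)) ≡ ∑ᵛ N (λ x → ∑ (λ ω → F ω x))
∑-∑ᵛ-comm r zero    F = refl
∑-∑ᵛ-comm r (suc N) F = trans (∑-distrib-+ _ (λ ω → ∑ᵛ N (F ω ∘ (true ∷_))))
  (cong₂ _+_ (∑-∑ᵛ-comm r N (λ ω → F ω ∘ (false ∷_))) (∑-∑ᵛ-comm r N (λ ω → F ω ∘ (true ∷_))))

∑ᵐ-mono : ∀ m {F G : List Bool → ℕ} → (∀ s → F s ≤ G s) → ∑ᵐ m F ≤ ∑ᵐ m G
∑ᵐ-mono zero    F≤G = F≤G []
∑ᵐ-mono (suc m) F≤G = +-mono-≤ (F≤G [])
  (+-mono-≤ (∑ᵐ-mono m (F≤G ∘ (false ∷_))) (∑ᵐ-mono m (F≤G ∘ (true ∷_))))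

-- There are `2 ^ suc m - 1` such strings; the extra `c` on the left avoids the subtraction.
∑ᵐ-const : ∀ m c → ∑ᵐ m (λ _ → c) + c ≡ 2 ^ suc m * c
∑ᵐ-const zero    c = cong (c +_) (sym (+-identityʳ c))
∑ᵐ-const (suc m) c = trans (regroup c (∑ᵐ m (λ _ → c))) (trans (cong (2 *_) (∑ᵐ-const m c))
  (sym (*-assoc 2 (2 ^ suc m) c)))
  where
  regroup : ∀ c s → c + (s + s) + c ≡ 2 * (s + c)
  regroup = solve-∀

∑ᵐ-term : ∀ m (F : List Bool → ℕ) s → length s ≤ m → F s ≤ ∑ᵐ m F
∑ᵐ-term zero    F []          _         = ≤-refl
∑ᵐ-term (suc m) F []          _         = m≤m+n _ _
∑ᵐ-term (suc m) F (false ∷ s) (s≤s s≤m) =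
  ≤-trans (∑ᵐ-term m _ s s≤m) (≤-trans (m≤m+n _ _) (m≤n+m _ (F [])))
∑ᵐ-term (suc m) F (true ∷ s)  (s≤s s≤m) =
  ≤-trans (∑ᵐ-term m _ s s≤m) (≤-trans (m≤n+m _ _) (m≤n+m _ (F [])))

∑ᵛ-∑ᵐ-comm : ∀ N m (F : Vec Bool N → List Bool → ℕ) →
             ∑ᵛ N (λ x → ∑ᵐ m (F x)) ≡ ∑ᵐ m (λ s → ∑ᵛ N (λ x → F x s))
∑ᵛ-∑ᵐ-comm N zero    F = refl
∑ᵛ-∑ᵐ-comm N (suc m) F = trans (∑ᵛ-+ N (λ x → F x []) _) (cong (∑ᵛ N (λ x → F x []) +_)
  (trans (∑ᵛ-+ N _ (λ x → ∑ᵐ m (F x ∘ (true ∷_))))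
    (cong₂ _+_ (∑ᵛ-∑ᵐ-comm N m (λ x → F x ∘ (false ∷_))) (∑ᵛ-∑ᵐ-comm N m (λ x → F x ∘ (true ∷_))))))

-- The one-way communication complexity of INDEX

_==_ : Bool → Bool → Bool
true  == b = b
false == b = not b

==-refl : ∀ b → (b == b) ≡ true
==-refl true  = refl
==-refl false = refl

agreement : ∀ {N} → (Fin N → Bool) → Vec Bool N → ℕ
agreement y x = ∑ (λ e → ι (y e == lookup x e))

-- The sum factors over the coordinates: the agreeing value of a bit contributes 2, the other value
-- 1.
∑ᵛ-2^agreement : ∀ N (y : Fin N → Bool) → ∑ᵛ N (λ x → 2 ^ agreement y x) ≡ 3 ^ N
∑ᵛ-2^agreement zero    y = refl
∑ᵛ-2^agreement (suc N) y with y zero | ∑ᵛ-2^agreement N (y ∘ suc)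
... | true  | ih rewrite ∑ᵛ-* N 2 (λ x → 2 ^ agreement (y ∘ suc) x) | ih = refl
... | false | ih rewrite ∑ᵛ-* N 2 (λ x → 2 ^ agreement (y ∘ suc) x) | ih = +-comm (2 * 3 ^ N) (3 ^ N)

1+n≤2^n : ∀ n → suc n ≤ 2 ^ n
1+n≤2^n zero    = ≤-refl
1+n≤2^n (suc n) = +-mono-≤ (≤-trans (s≤s z≤n) (1+n≤2^n n)) (≤-trans (1+n≤2^n n) (m≤m+n _ 0))

-- The line of slope 2^a through (a, 2^a) lies below g ↦ 2^g at the integers.
2^-tangent : ∀ a g → 2 ^ a * suc g ≤ 2 ^ g + 2 ^ a * a
2^-tangent zero    g       = ≤-trans (≤-reflexive (+-identityʳ (suc g))) (≤-trans (1+n≤2^n g) (m≤m+n _ 0))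
2^-tangent (suc a) zero    = ≤-trans
  (≤-trans (*-monoʳ-≤ (2 ^ suc a) (s≤s z≤n)) (m≤n+m _ 1)) ≤-refl
2^-tangent (suc a) (suc g) = begin
  2 ^ suc a * suc (suc g)              ≡⟨ lhs (2 ^ a) g ⟩
  2 * (2 ^ a * suc g) + 2 * 2 ^ a      ≤⟨ +-monoˡ-≤ (2 * 2 ^ a) (*-monoʳ-≤ 2 (2^-tangent a g)) ⟩
  2 * (2 ^ g + 2 ^ a * a) + 2 * 2 ^ a  ≡⟨ rhs (2 ^ a) (2 ^ g) a ⟩
  2 ^ suc g + 2 ^ suc a * suc a        ∎
  where
  open ≤-Reasoning
  lhs : ∀ p g → 2 * p * suc (suc g) ≡ 2 * (p * suc g) + 2 * p
  lhs = solve-∀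
  rhs : ∀ p q a → 2 * (q + p * a) + 2 * p ≡ 2 * q + 2 * p * suc a
  rhs = solve-∀

-- Convexity without real exponents: the tangent inequality at the integer `a` is summed over the
-- cube, and the hypothesis on the mean bounds its linear part.
∑ᵛ-2^-jensen : ∀ N a (g : Vec Bool N → ℕ) → 2 ^ N * a ≤ ∑ᵛ N g →
               2 ^ N * 2 ^ a ≤ ∑ᵛ N (λ x → 2 ^ g x)
∑ᵛ-2^-jensen N a g mean = +-cancelʳ-≤ (2 ^ N * (2 ^ a * a)) _ _ (begin
  2 ^ N * 2 ^ a + 2 ^ N * (2 ^ a * a)          ≡⟨ lhs (2 ^ N) (2 ^ a) a ⟩
  2 ^ a * (2 ^ N * 1 + 2 ^ N * a)              ≤⟨ *-monoʳ-≤ (2 ^ a) (+-monoʳ-≤ _ mean) ⟩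
  2 ^ a * (2 ^ N * 1 + ∑ᵛ N g)                 ≡⟨ cong (λ s → 2 ^ a * (s + ∑ᵛ N g)) (∑ᵛ-const N 1) ⟨
  2 ^ a * (∑ᵛ N (λ _ → 1) + ∑ᵛ N g)            ≡⟨ cong (2 ^ a *_) (∑ᵛ-+ N (λ _ → 1) g) ⟨
  2 ^ a * ∑ᵛ N (λ x → suc (g x))               ≡⟨ ∑ᵛ-* N (2 ^ a) (suc ∘ g) ⟨
  ∑ᵛ N (λ x → 2 ^ a * suc (g x))               ≤⟨ ∑ᵛ-mono N (λ x → 2^-tangent a (g x)) ⟩
  ∑ᵛ N (λ x → 2 ^ g x + 2 ^ a * a)             ≡⟨ ∑ᵛ-+ N (λ x → 2 ^ g x) _ ⟩
  ∑ᵛ N (λ x → 2 ^ g x) + ∑ᵛ N (λ _ → 2 ^ a * a) ≡⟨ cong (∑ᵛ N (λ x → 2 ^ g x) +_) (∑ᵛ-const N _) ⟩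
  ∑ᵛ N (λ x → 2 ^ g x) + 2 ^ N * (2 ^ a * a)   ∎)
  where
  open ≤-Reasoning
  lhs : ∀ P q a → P * q + P * (q * a) ≡ q * (P * 1 + P * a)
  lhs = solve-∀

∣S∣≤∑ : ∀ {r} (S : Subset r) (c : Fin r → Bool) → (∀ ω → ω ∈ₛ S → c ω ≡ true) → ∣ S ∣ ≤ ∑ (ι ∘ c)
∣S∣≤∑ []          c S⊆c = z≤n
∣S∣≤∑ (true ∷ S)  c S⊆c rewrite S⊆c zero here = s≤s (∣S∣≤∑ S (c ∘ suc) (λ ω → S⊆c (suc ω) ∘ there))
∣S∣≤∑ (false ∷ S) c S⊆c = ≤-trans (∣S∣≤∑ S (c ∘ suc) (λ ω → S⊆c (suc ω) ∘ there)) (m≤n+m _ _)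

-- Serves to fix the seed: some seed is at least average over all inputs, and from then on the
-- protocol is deterministic.
exists-above-average : ∀ r .⦃ _ : NonZero r ⦄ B (F : Fin r → ℕ) → r * B ≤ ∑ F → ∃ λ ω → B ≤ F ω
exists-above-average r B F r*B≤∑F with any? (λ ω → B ≤? F ω)
... | yes found = found
... | no  none  = contradiction (≤-trans (≤-reflexive (∑-const r B)) r*B≤∑F)
  (<⇒≱ (∑-mono-< (λ ω → ≰⇒> (λ B≤Fω → none (ω , B≤Fω)))))

^-distribʳ-* : ∀ t a b → (a * b) ^ t ≡ a ^ t * b ^ t
^-distribʳ-* zero    a b = refl
^-distribʳ-* (suc t) a b rewrite ^-distribʳ-* t a b = swap-middle a b (a ^ t) (b ^ t)
  where
  swap-middle : ∀ a b c d → a * b * (c * d) ≡ a * c * (b * d)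
  swap-middle = solve-∀

^-cancelˡ-≤ : ∀ {a b} → 2 ^ a ≤ 2 ^ b → a ≤ b
^-cancelˡ-≤ {a} {b} 2^a≤2^b with a ≤? b
... | yes a≤b = a≤b
... | no  a≰b = contradiction 2^a≤2^b (<⇒≱ (^-monoʳ-< 2 (s≤s (s≤s z≤n)) (≰⇒> a≰b)))

module _ (t r m : ℕ) .⦃ _ : NonZero r ⦄
         (msg : Fin r → Vec Bool (3 * (5 * t)) → List Bool)
         (dec : Fin r → List Bool → Fin (3 * (5 * t)) → Bool)
         (msg-short : ∀ ω x → length (msg ω x) ≤ m)
         (dec-correct : ∀ x e → Pr≥2/3 (λ ω → dec ω (msg ω x) e ≡ lookup x e)) where

  private
    -- The factor 3 makes `a`, two thirds of `N`, an integer. The factor 5 is the least positive `e`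
    -- with `2 * 27 ^ e ≤ 32 ^ e`, so that 15 input bits cost one message bit.
    N a : ℕ
    N = 3 * (5 * t)
    a = 2 * (5 * t)

    score : Fin r → Vec Bool N → ℕ
    score ω x = agreement (dec ω (msg ω x)) x

    success : ∀ x e → 2 * r ≤ 3 * ∑ (λ ω → ι (dec ω (msg ω x) e == lookup x e))
    success x e with dec-correct x e
    ... | S , S-correct , S-large = ≤-trans S-large (*-monoʳ-≤ 3
      (∣S∣≤∑ S _ (λ ω ω∈S → trans (cong (_== lookup x e) (S-correct ω ω∈S)) (==-refl (lookup x e)))))

    total-score : r * (2 ^ N * a) ≤ ∑ (λ ω → ∑ᵛ N (score ω))
    total-score = *-cancelˡ-≤ 3 (begin
      3 * (r * (2 ^ N * a))                            ≡⟨ regroup r (2 ^ N) t ⟩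
      2 ^ N * (N * (2 * r))                            ≡⟨ ∑ᵛ-const N _ ⟨
      ∑ᵛ N (λ x → N * (2 * r))                         ≡⟨ ∑ᵛ-cong N (λ x → ∑-const N _) ⟨
      ∑ᵛ N (λ x → ∑ {N} (λ e → 2 * r))                 ≤⟨ ∑ᵛ-mono N (λ x → ∑-mono (success x)) ⟩
      ∑ᵛ N (λ x → ∑ (λ e → 3 * ∑ (λ ω → hit ω x e)))   ≡⟨ ∑ᵛ-cong N (λ x → *-distribˡ-∑ 3 (λ e → ∑ (λ ω → hit ω x e))) ⟩
      ∑ᵛ N (λ x → 3 * ∑ (λ e → ∑ (λ ω → hit ω x e)))   ≡⟨ ∑ᵛ-* N 3 _ ⟩
      3 * ∑ᵛ N (λ x → ∑ (λ e → ∑ (λ ω → hit ω x e)))   ≡⟨ cong (3 *_) (∑ᵛ-cong N (λ x → ∑-comm (λ e ω → hit ω x e))) ⟩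
      3 * ∑ᵛ N (λ x → ∑ (λ ω → score ω x))             ≡⟨ cong (3 *_) (∑-∑ᵛ-comm r N score) ⟨
      3 * ∑ (λ ω → ∑ᵛ N (score ω))                     ∎)
      where
      open ≤-Reasoning
      hit : Fin r → Vec Bool N → Fin N → ℕ
      hit ω x e = ι (dec ω (msg ω x) e == lookup x e)
      regroup : ∀ r P t → 3 * (r * (P * (2 * (5 * t)))) ≡ P * (3 * (5 * t) * (2 * r))
      regroup = solve-∀

    counting : 2 ^ N * 2 ^ a ≤ 2 ^ suc m * 3 ^ N
    counting with exists-above-average r _ _ total-score
    ... | ω , ω-good = begin
      2 ^ N * 2 ^ a                                            ≤⟨ ∑ᵛ-2^-jensen N a (score ω) ω-good ⟩
      -- The guess depends on the input through the message. Summing over all short messages removes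
      -- this dependence: each `s` comes with one fixed guess.
      ∑ᵛ N (λ x → 2 ^ score ω x)                               ≤⟨ ∑ᵛ-mono N (λ x → ∑ᵐ-term m (λ s → 2 ^ agreement (dec ω s) x) (msg ω x) (msg-short ω x)) ⟩
      ∑ᵛ N (λ x → ∑ᵐ m (λ s → 2 ^ agreement (dec ω s) x))      ≡⟨ ∑ᵛ-∑ᵐ-comm N m _ ⟩
      ∑ᵐ m (λ s → ∑ᵛ N (λ x → 2 ^ agreement (dec ω s) x))      ≤⟨ ∑ᵐ-mono m (λ s → ≤-reflexive (∑ᵛ-2^agreement N (dec ω s))) ⟩
      ∑ᵐ m (λ s → 3 ^ N)                                       ≤⟨ m≤m+n _ (3 ^ N) ⟩
      ∑ᵐ m (λ s → 3 ^ N) + 3 ^ N                               ≡⟨ ∑ᵐ-const m (3 ^ N) ⟩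
      2 ^ suc m * 3 ^ N                                        ∎
      where open ≤-Reasoning

  -- 2^(N+a) = (32^5)^t while 3^N = (27^5)^t, and 2 · 27^5 ≤ 32^5.
  index-lower-bound : t ≤ suc m
  index-lower-bound = ^-cancelˡ-≤ (*-cancelʳ-≤ (2 ^ t) (2 ^ suc m) (3 ^ N) ⦃ m^n≢0 3 N ⦄ (begin
    2 ^ t * 3 ^ N           ≡⟨ cong (λ e → 2 ^ t * 3 ^ e) (*-assoc 3 5 t) ⟨
    2 ^ t * 3 ^ (15 * t)    ≡⟨ cong (2 ^ t *_) (^-*-assoc 3 15 t) ⟨
    2 ^ t * (3 ^ 15) ^ t    ≡⟨ ^-distribʳ-* t 2 (3 ^ 15) ⟨
    (2 * 3 ^ 15) ^ t        ≤⟨ ^-monoˡ-≤ t (≤ᵇ⇒≤ (2 * 3 ^ 15) (2 ^ 25) _) ⟩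
    (2 ^ 25) ^ t            ≡⟨ ^-*-assoc 2 25 t ⟩
    2 ^ (25 * t)            ≡⟨ cong (2 ^_) (regroup t) ⟩
    2 ^ (N + a)             ≡⟨ ^-distribˡ-+-* 2 N a ⟩
    2 ^ N * 2 ^ a           ≤⟨ counting ⟩
    2 ^ suc m * 3 ^ N       ∎))
    where
    open ≤-Reasoning
    regroup : ∀ t → 25 * t ≡ 3 * (5 * t) + 2 * (5 * t)
    regroup = solve-∀

-- Unique lists

Unique-++⁻ : ∀ {A : Set} (xs : List A) {ys} → Unique (xs ++ ys) →
             Unique xs × Unique ys × Disjoint xs ys
Unique-++⁻ []       ys! = [] , ys! , λ { (() , _) }
Unique-++⁻ (x ∷ xs) (x∉ ∷ xs++ys!) with Unique-++⁻ xs xs++ys!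
... | xs! , ys! , xs#ys = Allₚ.++⁻ˡ xs x∉ ∷ xs! , ys! , disjoint
  where
  disjoint : Disjoint (x ∷ xs) _
  disjoint (here refl  , v∈ys) = All.lookup (Allₚ.++⁻ʳ xs x∉) v∈ys refl
  disjoint (there v∈xs , v∈ys) = xs#ys (v∈xs , v∈ys)

Unique-resp-↭ : ∀ {A : Set} {xs ys : List A} → xs ↭ ys → Unique xs → Unique ys
Unique-resp-↭ {A} p = Permutationₛ.AllPairs-resp-↭ (setoid A) ≢-sym (resp₂ _≢_) (↭⇒↭ₛ p)

module _ {A : Set} where

  Unique-concat⁻ : ∀ {k} (f : Fin k → List A) → Unique (concat (tabulate f)) →
                   (∀ i → Unique (f i)) × (∀ {i j v} → v ∈ f i → v ∈ f j → i ≡ j)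
  Unique-concat⁻ {zero}  f _ = (λ ()) , λ {i} → λ _ _ → ⊥-elim (Fin0 i)
    where
    Fin0 : Fin 0 → ⊥
    Fin0 ()
  Unique-concat⁻ {suc k} f f! with Unique-++⁻ (f zero) f!
  ... | f₀! , rest! , f₀#rest with Unique-concat⁻ (f ∘ suc) rest!
  ...   | fs! , fs# = unique , disjoint
    where
    unique : ∀ i → Unique (f i)
    unique zero    = f₀!
    unique (suc i) = fs! i
    in-rest : ∀ {v} i → v ∈ f (suc i) → v ∈ concat (tabulate (f ∘ suc))
    in-rest i v∈ = ∈-concat⁺′ v∈ (∈-tabulate⁺ i)
    disjoint : ∀ {i j v} → v ∈ f i → v ∈ f j → i ≡ j
    disjoint {zero}  {zero}  _   _   = refl
    disjoint {zero}  {suc j} v∈₀ v∈ⱼ = ⊥-elim (f₀#rest (v∈₀ , in-rest j v∈ⱼ))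
    disjoint {suc i} {zero}  v∈ᵢ v∈₀ = ⊥-elim (f₀#rest (v∈₀ , in-rest i v∈ᵢ))
    disjoint {suc i} {suc j} v∈ᵢ v∈ⱼ = cong suc (fs# v∈ᵢ v∈ⱼ)

_∈?_ : ∀ {n} (v : Fin n) (xs : List (Fin n)) → Dec (v ∈ xs)
_∈?_ = DecMembership._∈?_ _≟_

δ : ∀ {n} → Fin n → Fin n → ℕ
δ i j = ι (does (i ≟ j))

∑-δ : ∀ {n} (j : Fin n) (f : Fin n → ℕ) → ∑ (λ i → δ i j * f i) ≡ f j
∑-δ {suc n} zero    f = trans (cong₂ _+_ (+-identityʳ (f zero)) (trans (∑-const n 0) (*-zeroʳ n))) (+-identityʳ (f zero))
∑-δ {suc n} (suc j) f = ∑-δ j (f ∘ suc)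

length-unique : ∀ {n} {xs : List (Fin n)} → Unique xs → length xs ≡ ∑ (λ z → ι (does (z ∈? xs)))
length-unique {n} {[]}     []          = sym (trans (∑-const n 0) (*-zeroʳ n))
length-unique {n} {x ∷ xs} xs!@(_ ∷ xs!′) = sym (trans (sum-cong-≗ split)
  (trans (∑-distrib-+ (λ z → δ z x * 1) (λ z → ι (does (z ∈? xs))))
    (cong₂ _+_ (∑-δ x (λ _ → 1)) (sym (length-unique xs!′)))))
  where
  split : ∀ z → ι (does (z ∈? (x ∷ xs))) ≡ δ z x * 1 + ι (does (z ∈? xs))
  split z with z ≟ x | z ∈? xs
  ... | yes refl | yes x∈xs = contradiction x∈xs (Uniqueₚ.Unique[x∷xs]⇒x∉xs xs!)
  ... | yes _    | no  _    = refl
  ... | no  _    | yes _    = refl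
  ... | no  _    | no  _    = refl

-- Lowest common ancestors

module _ {n : ℕ} where

  ∈-child⁺ : ∀ {k} (c : Fin (suc k) → Tree n) i {v} → v ∈ leaves (c i) → v ∈ leaves (node c)
  ∈-child⁺ c i v∈ = ∈-concat⁺′ v∈ (∈-tabulate⁺ {f = leaves ∘ c} i)

  ∈-child⁻ : ∀ {k} (c : Fin (suc k) → Tree n) {v} → v ∈ leaves (node c) → ∃ λ i → v ∈ leaves (c i)
  ∈-child⁻ c v∈ with ∈-concat⁻′ (tabulate (leaves ∘ c)) v∈
  ... | xs , v∈xs , xs∈ with ∈-tabulate⁻ {f = leaves ∘ c} xs∈
  ...   | i , refl = i , v∈xs

  some-leaf : (t : Tree n) → ∃ λ v → v ∈ leaves t
  some-leaf (leaf v) = v , here refl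
  some-leaf (node c) with some-leaf (c zero)
  ... | v , v∈ = v , ∈-child⁺ c zero v∈

  -- Uniqueness of the leaves unfolded along the tree, in the form in which an induction can pass to
  -- a child.
  Distinct : Tree n → Set
  Distinct (leaf _) = ⊤
  Distinct (node c) = (∀ i → Distinct (c i)) ×
    (∀ {i j v} → v ∈ leaves (c i) → v ∈ leaves (c j) → i ≡ j)

  Unique⇒Distinct : ∀ (t : Tree n) → Unique (leaves t) → Distinct t
  Unique⇒Distinct (leaf _) _ = tt
  Unique⇒Distinct (node c) t! with Unique-concat⁻ (leaves ∘ c) t!
  ... | c! , c# = (λ i → Unique⇒Distinct (c i) (c! i)) , c#

  module _ {k} (c : Fin (suc k) → Tree n) where

    -- `lca` descends into whichever child the search returns; as no leaf lies under two children,
    -- that child is `c i`.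
    lca-child : Distinct (node c) → ∀ {i u v} → u ∈ leaves (c i) → v ∈ leaves (c i) →
                lca (node c) u v ≡ lca (c i) u v
    lca-child (_ , c#) {i} {u} {v} u∈ v∈
      with any? (λ j → (u ∈? leaves (c j)) ×-dec (v ∈? leaves (c j)))
    ... | yes (j , u∈ⱼ , _) rewrite c# u∈ u∈ⱼ = refl
    ... | no  none          = contradiction (i , u∈ , v∈) none

    lca-root : ∀ {u v} → (∀ i → u ∈ leaves (c i) → v ∈ leaves (c i) → ⊥) → lca (node c) u v ≡ node c
    lca-root {u} {v} apart
      with any? (λ j → (u ∈? leaves (c j)) ×-dec (v ∈? leaves (c j)))
    ... | yes (j , u∈ , v∈) = ⊥-elim (apart j u∈ v∈)
    ... | no  _             = refl

    lca-apart : Distinct (node c) → ∀ {i j u v} → i ≢ j → u ∈ leaves (c i) → v ∈ leaves (c j) →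
                lca (node c) u v ≡ node c
    lca-apart (_ , c#) i≢j u∈ v∈ = lca-root (λ m u∈ₘ v∈ₘ → i≢j (trans (c# u∈ u∈ₘ) (c# v∈ₘ v∈)))

  lca-∋ˡ : ∀ (t : Tree n) {u v} → u ∈ leaves t → u ∈ leaves (lca t u v)
  lca-∋ˡ (leaf _) u∈ = u∈
  lca-∋ˡ (node c) {u} {v} u∈
    with any? (λ j → (u ∈? leaves (c j)) ×-dec (v ∈? leaves (c j)))
  ... | yes (j , u∈ⱼ , _) = lca-∋ˡ (c j) {u} {v} u∈ⱼ
  ... | no  _             = u∈

  lca-∋ʳ : ∀ (t : Tree n) {u v} → v ∈ leaves t → v ∈ leaves (lca t u v)
  lca-∋ʳ (leaf _) v∈ = v∈
  lca-∋ʳ (node c) {u} {v} v∈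
    with any? (λ j → (u ∈? leaves (c j)) ×-dec (v ∈? leaves (c j)))
  ... | yes (j , _ , v∈ⱼ) = lca-∋ʳ (c j) {u} {v} v∈ⱼ
  ... | no  _             = v∈

  lca-⊆ : ∀ (t : Tree n) {u v w} → w ∈ leaves (lca t u v) → w ∈ leaves t
  lca-⊆ (leaf _) w∈ = w∈
  lca-⊆ (node c) {u} {v} w∈
    with any? (λ j → (u ∈? leaves (c j)) ×-dec (v ∈? leaves (c j)))
  ... | yes (j , _) = ∈-child⁺ c j (lca-⊆ (c j) {u} {v} w∈)
  ... | no  _       = w∈

  lca-unique : ∀ (t : Tree n) {u v} → Unique (leaves t) → Unique (leaves (lca t u v))
  lca-unique (leaf _) t! = t!
  lca-unique (node c) {u} {v} t!
    with any? (λ j → (u ∈? leaves (c j)) ×-dec (v ∈? leaves (c j)))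
  ... | yes (j , _) = lca-unique (c j) {u} {v} (proj₁ (Unique-concat⁻ (leaves ∘ c) t!) j)
  ... | no  _       = t!

  lca-comm : ∀ (t : Tree n) {u v} → Distinct t → u ∈ leaves t → v ∈ leaves t → lca t u v ≡ lca t v u
  lca-comm (leaf _) _ _ _ = refl
  lca-comm (node c) d u∈ v∈ with ∈-child⁻ c u∈ | ∈-child⁻ c v∈
  ... | i , u∈ᵢ | j , v∈ⱼ with i ≟ j
  ...   | yes refl = trans (lca-child c d u∈ᵢ v∈ⱼ)
                       (trans (lca-comm (c i) (proj₁ d i) u∈ᵢ v∈ⱼ) (sym (lca-child c d v∈ⱼ u∈ᵢ)))
  ...   | no  i≢j  = trans (lca-apart c d i≢j u∈ᵢ v∈ⱼ) (sym (lca-apart c d (i≢j ∘ sym) v∈ⱼ u∈ᵢ))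

  lca-diag : ∀ (t : Tree n) {u} → Distinct t → u ∈ leaves t → leaves (lca t u u) ≡ [ u ]
  lca-diag (leaf _) _ (here refl) = refl
  lca-diag (node c) d u∈ with ∈-child⁻ c u∈
  ... | i , u∈ᵢ = trans (cong leaves (lca-child c d u∈ᵢ u∈ᵢ)) (lca-diag (c i) (proj₁ d i) u∈ᵢ)

  -- The negation of the triple relation uv|z.
  Below : Tree n → Fin n → Fin n → Fin n → Set
  Below t u v z = z ∈ leaves (lca t u v)

  TwoOf : Set → Set → Set → Set
  TwoOf A B C = (A × B) ⊎ (A × C) ⊎ (B × C)

  -- Descend until the three leaves are no longer under one child. At least two of the three pairs
  -- are then split, and the join of a split pair is the whole node, which contains the third leaf.
  below-two : ∀ (t : Tree n) {u v z} → Distinct t → u ∈ leaves t → v ∈ leaves t → z ∈ leaves t →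
              TwoOf (Below t u v z) (Below t u z v) (Below t v z u)
  below-two (leaf _) _ u∈ v∈ z∈ = inj₁ (z∈ , v∈)
  below-two (node c) {u} {v} {z} d u∈ v∈ z∈ with ∈-child⁻ c u∈ | ∈-child⁻ c v∈ | ∈-child⁻ c z∈
  ... | i , u∈ᵢ | j , v∈ⱼ | l , z∈ₗ with i ≟ j | i ≟ l | j ≟ l
  ...   | yes refl | yes refl | _
    rewrite lca-child c d u∈ᵢ v∈ⱼ | lca-child c d u∈ᵢ z∈ₗ | lca-child c d v∈ⱼ z∈ₗ =
      below-two (c i) (proj₁ d i) u∈ᵢ v∈ⱼ z∈ₗ
  ...   | yes refl | no i≢l   | _      rewrite lca-apart c d i≢l u∈ᵢ z∈ₗ | lca-apart c d i≢l v∈ⱼ z∈ₗ =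
      inj₂ (inj₂ (v∈ , u∈))
  ...   | no i≢j   | yes refl | _      rewrite lca-apart c d i≢j u∈ᵢ v∈ⱼ | lca-apart c d (i≢j ∘ sym) v∈ⱼ z∈ₗ =
      inj₂ (inj₁ (z∈ , u∈))
  ...   | no i≢j   | no i≢l   | _      rewrite lca-apart c d i≢j u∈ᵢ v∈ⱼ | lca-apart c d i≢l u∈ᵢ z∈ₗ =
      inj₁ (z∈ , v∈)

  -- A `node` has `suc k` children, so `k ≡ 1` means exactly two; unary nodes are excluded.
  Binary : Tree n → Set
  Binary (leaf _)       = ⊤
  Binary (node {k} c) = k ≡ 1 × (∀ i → Binary (c i))

  NotAll : Set → Set → Set → Set
  NotAll A B C = ¬ A ⊎ ¬ B ⊎ ¬ C

  -- Where three leaves part, two of them share one of the two children by pigeonhole, and their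
  -- join misses the third. Leaves that never part are equal.
  below-not-all : ∀ (t : Tree n) {u v z} → Distinct t → Binary t → u ∈ leaves t → v ∈ leaves t → z ∈ leaves t →
                  (u ≡ v × v ≡ z) ⊎ NotAll (Below t u v z) (Below t u z v) (Below t v z u)
  below-not-all (leaf _) _ _ (here refl) (here refl) (here refl) = inj₁ (refl , refl)
  below-not-all (node c) {u} {v} {z} d (refl , b) u∈ v∈ z∈ with ∈-child⁻ c u∈ | ∈-child⁻ c v∈ | ∈-child⁻ c z∈
  ... | i , u∈ᵢ | j , v∈ⱼ | l , z∈ₗ with i ≟ j | i ≟ l | j ≟ l
  ...   | yes refl | yes refl | _
    rewrite lca-child c d u∈ᵢ v∈ⱼ | lca-child c d u∈ᵢ z∈ₗ | lca-child c d v∈ⱼ z∈ₗ =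
      below-not-all (c i) (proj₁ d i) (b i) u∈ᵢ v∈ⱼ z∈ₗ
  ...   | yes refl | no i≢l   | _ rewrite lca-child c d u∈ᵢ v∈ⱼ =
      inj₂ (inj₁ (λ z∈′ → i≢l (proj₂ d (lca-⊆ (c i) z∈′) z∈ₗ)))
  ...   | no i≢j   | yes refl | _ rewrite lca-child c d u∈ᵢ z∈ₗ =
      inj₂ (inj₂ (inj₁ (λ v∈′ → i≢j (proj₂ d (lca-⊆ (c i) v∈′) v∈ⱼ))))
  ...   | no i≢j   | no _     | yes refl rewrite lca-child c d v∈ⱼ z∈ₗ =
      inj₂ (inj₂ (inj₂ (λ u∈′ → i≢j (proj₂ d u∈ᵢ (lca-⊆ (c j) u∈′)))))
  ...   | no i≢j   | no i≢l   | no j≢l = ⊥-elim (pigeon i j l i≢j i≢l j≢l)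
    where
    pigeon : (i j l : Fin 2) → i ≢ j → i ≢ l → j ≢ l → ⊥
    pigeon zero       zero       _          i≢j _   _   = i≢j refl
    pigeon zero       (suc zero) zero       _   i≢l _   = i≢l refl
    pigeon zero       (suc zero) (suc zero) _   _   j≢l = j≢l refl
    pigeon (suc zero) (suc zero) _          i≢j _   _   = i≢j refl
    pigeon (suc zero) zero       (suc zero) _   i≢l _   = i≢l refl
    pigeon (suc zero) zero       zero       _   _   j≢l = j≢l refl

  -- Only one implication is recorded: pairs split by `U` meet at the top. Pairs on one side may
  -- meet there too, when the top node has more than two children.
  RootCut : Tree n → Set
  RootCut t = ∃ λ (U : Fin n → Bool) → (∃₂ λ u v → U u ≢ U v) ×
    (∀ {u v z} → u ∈ leaves t → v ∈ leaves t → z ∈ leaves t → U u ≢ U v → Below t u v z)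

  -- Unary nodes at the top are skipped; at the first node with several children, the first child is
  -- set against all others. Two distinct leaves guarantee that such a node exists.
  root-cut : ∀ (t : Tree n) → Distinct t → ∀ {a b} → a ∈ leaves t → b ∈ leaves t → a ≢ b → RootCut t
  root-cut (leaf _) _ (here refl) (here refl) a≢b = contradiction refl a≢b
  root-cut (node {zero} c) d {a} {b} a∈ b∈ a≢b = lift (root-cut (c zero) (proj₁ d zero) (only a∈) (only b∈) a≢b)
    where
    only : ∀ {v} → v ∈ leaves (node c) → v ∈ leaves (c zero)
    only v∈ with ∈-child⁻ c v∈
    ... | zero , v∈₀ = v∈₀
    lift : RootCut (c zero) → RootCut (node c)
    lift (U , nontrivial , cut) = U , nontrivial , λ {_} {_} {z} u∈ v∈ z∈ Uu≢Uv →
      subst (λ s → z ∈ leaves s) (sym (lca-child c d (only u∈) (only v∈))) (cut (only u∈) (only v∈) (only z∈) Uu≢Uv)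
  root-cut (node {suc k} c) d a∈ b∈ a≢b = U , (u₀ , u₁ , U₀≢U₁) , cut
    where
    U : Fin n → Bool
    U z = does (z ∈? leaves (c zero))
    u₀ u₁ : Fin n
    u₀ = proj₁ (some-leaf (c zero))
    u₁ = proj₁ (some-leaf (c (suc zero)))
    inside : ∀ {v} → v ∈ leaves (c zero) → U v ≡ true
    inside v∈ = dec-true (_ ∈? _) v∈
    outside : ∀ {v i} → v ∈ leaves (c (suc i)) → U v ≡ false
    outside v∈ = dec-false (_ ∈? _) (λ v∈₀ → 0≢1+n (proj₂ d v∈₀ v∈))
    U₀≢U₁ : U u₀ ≢ U u₁
    U₀≢U₁ eq with trans (sym (inside (proj₂ (some-leaf (c zero))))) (trans eq (outside (proj₂ (some-leaf (c (suc zero))))))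
    ... | ()
    cut : ∀ {u v z} → u ∈ leaves (node c) → v ∈ leaves (node c) → z ∈ leaves (node c) → U u ≢ U v → Below (node c) u v z
    cut {u} {v} {z} u∈ v∈ z∈ Uu≢Uv = subst (λ s → z ∈ leaves s) (sym (lca-root c apart)) z∈
      where
      apart : ∀ i → u ∈ leaves (c i) → v ∈ leaves (c i) → ⊥
      apart zero    u∈₀ v∈₀ = Uu≢Uv (trans (inside u∈₀) (sym (inside v∈₀)))
      apart (suc i) u∈ᵢ v∈ᵢ = Uu≢Uv (trans (outside u∈ᵢ) (sym (outside v∈ᵢ)))

  -- Caterpillars

  pair : Tree n → Tree n → Fin 2 → Tree n
  pair l r zero    = l
  pair l r (suc _) = r

  node₂ : Tree n → Tree n → Tree n
  node₂ l r = node (pair l r)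

  leaves-node₂ : ∀ l r → leaves (node₂ l r) ≡ leaves l ++ leaves r
  leaves-node₂ l r = cong (leaves l ++_) (++-identityʳ (leaves r))

  Binary-node₂ : ∀ {l r} → Binary l → Binary r → Binary (node₂ l r)
  Binary-node₂ bl br = refl , λ { zero → bl ; (suc _) → br }

  cat : Fin n → List (Fin n) → Tree n
  cat x []       = leaf x
  cat x (y ∷ ys) = node₂ (leaf x) (cat y ys)

  leaves-cat : ∀ x xs → leaves (cat x xs) ≡ x ∷ xs
  leaves-cat x []       = refl
  leaves-cat x (y ∷ ys) = trans (leaves-node₂ (leaf x) (cat y ys)) (cong (x ∷_) (leaves-cat y ys))

  Binary-cat : ∀ x xs → Binary (cat x xs)
  Binary-cat x []       = tt
  Binary-cat x (y ∷ ys) = Binary-node₂ {leaf x} tt (Binary-cat y ys)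

  -- The head hangs directly from the root, so every pair of a star centred at the head is joined as
  -- high as the caterpillar allows.
  lca-cat-head : ∀ x xs → Unique (x ∷ xs) → ∀ {v} → v ∈ xs → lca (cat x xs) x v ≡ cat x xs
  lca-cat-head x (y ∷ ys) xs! {v} v∈ = lca-root children apart
    where
    children : Fin 2 → Tree n
    children = pair (leaf x) (cat y ys)
    apart : ∀ i → x ∈ leaves (children i) → v ∈ leaves (children i) → ⊥
    apart zero    _    (here refl) = Uniqueₚ.Unique[x∷xs]⇒x∉xs xs! v∈
    apart (suc _) x∈   _           = Uniqueₚ.Unique[x∷xs]⇒x∉xs xs! (subst (x ∈_) (leaves-cat y ys) x∈)

-- Double and triple sums

module _ {n : ℕ} where

  ∑₂ : (Fin n → Fin n → ℕ) → ℕ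
  ∑₂ F = ∑ (λ u → ∑ (F u))

  ∑₃ : (Fin n → Fin n → Fin n → ℕ) → ℕ
  ∑₃ F = ∑ (λ u → ∑₂ (F u))

  ∑₂-cong : ∀ {F G : Fin n → Fin n → ℕ} → (∀ u v → F u v ≡ G u v) → ∑₂ F ≡ ∑₂ G
  ∑₂-cong F≡G = sum-cong-≗ (λ u → sum-cong-≗ (F≡G u))

  ∑₃-cong : ∀ {F G : Fin n → Fin n → Fin n → ℕ} → (∀ u v z → F u v z ≡ G u v z) → ∑₃ F ≡ ∑₃ G
  ∑₃-cong F≡G = sum-cong-≗ (λ u → ∑₂-cong (F≡G u))

  ∑₃-mono : ∀ {F G : Fin n → Fin n → Fin n → ℕ} → (∀ u v z → F u v z ≤ G u v z) → ∑₃ F ≤ ∑₃ G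
  ∑₃-mono F≤G = ∑-mono (λ u → ∑-mono (λ v → ∑-mono (F≤G u v)))

  ∑₂-+ : ∀ (F G : Fin n → Fin n → ℕ) → ∑₂ (λ u v → F u v + G u v) ≡ ∑₂ F + ∑₂ G
  ∑₂-+ F G = trans (sum-cong-≗ (λ u → ∑-distrib-+ (F u) (G u))) (∑-distrib-+ (λ u → ∑ (F u)) (λ u → ∑ (G u)))

  ∑₃-+ : ∀ (F G : Fin n → Fin n → Fin n → ℕ) → ∑₃ (λ u v z → F u v z + G u v z) ≡ ∑₃ F + ∑₃ G
  ∑₃-+ F G = trans (sum-cong-≗ (λ u → ∑₂-+ (F u) (G u))) (∑-distrib-+ (λ u → ∑₂ (F u)) (λ u → ∑₂ (G u)))

  ∑₃-const : ∀ c → ∑₃ (λ _ _ _ → c) ≡ n * (n * (n * c))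
  ∑₃-const c = trans (sum-cong-≗ {n} (λ _ → trans (sum-cong-≗ {n} (λ _ → ∑-const n c)) (∑-const n _))) (∑-const n _)

  ∑₃-ignore : ∀ (F : Fin n → Fin n → ℕ) → ∑₃ (λ u v _ → F u v) ≡ n * ∑₂ F
  ∑₃-ignore F = trans (∑₂-cong (λ u v → ∑-const n (F u v)))
    (trans (sum-cong-≗ (λ u → *-distribˡ-∑ n (F u))) (*-distribˡ-∑ n (λ u → ∑ (F u))))

  -- Turns a bound on the three pairs inside each triple into a bound on a single sum, of which each
  -- summand is a reindexing.
  ∑₃-rotations : ∀ (F : Fin n → Fin n → Fin n → ℕ) →
                 ∑₃ (λ u v z → F u v z + (F u z v + F v z u)) ≡ 3 * ∑₃ F
  ∑₃-rotations F = begin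
    ∑₃ (λ u v z → F u v z + (F u z v + F v z u))                ≡⟨ ∑₃-+ F _ ⟩
    ∑₃ F + ∑₃ (λ u v z → F u z v + F v z u)                     ≡⟨ cong (∑₃ F +_) (∑₃-+ (λ u v z → F u z v) (λ u v z → F v z u)) ⟩
    ∑₃ F + (∑₃ (λ u v z → F u z v) + ∑₃ (λ u v z → F v z u))    ≡⟨ cong₂ (λ a b → ∑₃ F + (a + b)) last-two rotate ⟩
    ∑₃ F + (∑₃ F + ∑₃ F)                                        ≡⟨ triple (∑₃ F) ⟩
    3 * ∑₃ F                                                    ∎
    where
    open ≡-Reasoning
    last-two : ∑₃ (λ u v z → F u z v) ≡ ∑₃ F
    last-two = sum-cong-≗ (λ u → ∑-comm (λ v z → F u z v))
    rotate : ∑₃ (λ u v z → F v z u) ≡ ∑₃ F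
    rotate = trans (∑-comm (λ u v → ∑ (λ z → F v z u))) (sum-cong-≗ (λ v → ∑-comm (λ u z → F v z u)))
    triple : ∀ a → a + (a + a) ≡ 3 * a
    triple = solve-∀

  -- The summand is the number of pairs of a triple whose join lies above the third vertex, in a
  -- binary tree. The factor 1 gives the shape required by `∑-δ`.
  ∑₃-diagonal : ∑₃ (λ u v z → 2 + δ u v * (δ v z * 1)) ≡ 2 * (n * (n * n)) + n
  ∑₃-diagonal = begin
    ∑₃ (λ u v z → 2 + δ u v * (δ v z * 1))                 ≡⟨ ∑₃-+ (λ _ _ _ → 2) (λ u v z → δ u v * (δ v z * 1)) ⟩
    ∑₃ (λ _ _ _ → 2) + ∑₃ (λ u v z → δ u v * (δ v z * 1))  ≡⟨ cong₂ _+_ (∑₃-const 2) diagonal ⟩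
    n * (n * (n * 2)) + n                                  ≡⟨ cong (_+ n) (regroup n) ⟩
    2 * (n * (n * n)) + n                                  ∎
    where
    open ≡-Reasoning
    regroup : ∀ n → n * (n * (n * 2)) ≡ 2 * (n * (n * n))
    regroup = solve-∀
    row : Fin n → ℕ
    row v = ∑ (λ z → δ v z * 1)
    diagonal : ∑₃ (λ u v z → δ u v * (δ v z * 1)) ≡ n
    diagonal = begin
      ∑₃ (λ u v z → δ u v * (δ v z * 1))   ≡⟨ ∑₂-cong (λ u v → *-distribˡ-∑ (δ u v) (λ z → δ v z * 1)) ⟩
      ∑₂ (λ u v → δ u v * row v)           ≡⟨ ∑-comm (λ u v → δ u v * row v) ⟩
      ∑₂ (λ v u → δ u v * row v)           ≡⟨ sum-cong-≗ (λ v → ∑-δ v (λ _ → row v)) ⟩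
      ∑ row                                ≡⟨ ∑-comm {n} {n} (λ v z → δ v z * 1) ⟩
      ∑₂ (λ z v → δ v z * 1)               ≡⟨ sum-cong-≗ {n} (λ z → ∑-δ z (λ _ → 1)) ⟩
      ∑ {n} (λ _ → 1)                      ≡⟨ ∑-const n 1 ⟩
      n * 1                                ≡⟨ *-identityʳ n ⟩
      n                                    ∎

-- Edge lists of adjacency relations

edge-≡ : ∀ {n} {e f : Edge n} → Edge.src e ≡ Edge.src f → Edge.tgt e ≡ Edge.tgt f → e ≡ f
edge-≡ {e = edge u v p} {edge _ _ q} refl refl = cong (edge u v) (<-irrelevant p q)

lift : ∀ {n} → Edge n → Edge (suc n)
lift (edge u v u<v) = edge (suc u) (suc v) (s≤s u<v)

allEdges : ∀ n → List (Edge n)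
allEdges zero    = []
allEdges (suc n) = tabulate (λ v → edge zero (suc v) (s≤s z≤n)) ++ map lift (allEdges n)

allEdges-unique : ∀ n → Unique (allEdges n)
allEdges-unique zero    = []
allEdges-unique (suc n) = Uniqueₚ.++⁺
  (Uniqueₚ.tabulate⁺ (suc-injective ∘ cong Edge.tgt))
  (Uniqueₚ.map⁺ (λ e≡f → edge-≡ (suc-injective (cong Edge.src e≡f)) (suc-injective (cong Edge.tgt e≡f)))
    (allEdges-unique n))
  disjoint
  where
  star : Fin n → Edge (suc n)
  star v = edge zero (suc v) (s≤s z≤n)
  disjoint : ∀ {e} → e ∈ tabulate star × e ∈ map lift (allEdges n) → ⊥
  disjoint (e∈ , e∈′) with ∈-tabulate⁻ {f = star} e∈ | ∈-map⁻ lift e∈′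
  ... | _ , refl | _ , _ , ()

onEdge : ∀ {n} {A : Set} → (Fin n → Fin n → A) → Edge n → A
onEdge w e = w (Edge.src e) (Edge.tgt e)

Symmetric₂ : ∀ {n} {A : Set} → (Fin n → Fin n → A) → Set
Symmetric₂ w = ∀ u v → w u v ≡ w v u

sum-tabulate : ∀ {n} (f : Fin n → ℕ) → sum (tabulate f) ≡ ∑ f
sum-tabulate {zero}  f = refl
sum-tabulate {suc n} f = cong (f zero +_) (sum-tabulate (f ∘ suc))

-- Passes from unordered to ordered pairs. Peeling off vertex `zero` leaves its row and its column,
-- which agree by symmetry.
allEdges-sum : ∀ n (w : Fin n → Fin n → ℕ) → Symmetric₂ w →
               2 * sum (map (onEdge w) (allEdges n)) + ∑ (λ u → w u u) ≡ ∑₂ w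
allEdges-sum zero    w w-sym = refl
allEdges-sum (suc n) w w-sym = begin
  2 * sum (map (onEdge w) (star ++ map lift (allEdges n))) + (w zero zero + D)  ≡⟨ cong (λ s → 2 * s + (w zero zero + D)) split ⟩
  2 * (A + B) + (w zero zero + D)                      ≡⟨ regroup A B (w zero zero) D ⟩
  (w zero zero + A) + (A + (2 * B + D))                ≡⟨ cong₂ (λ a b → (w zero zero + A) + (a + b))
                                                           (sum-cong-≗ (λ v → w-sym zero (suc v)))
                                                           (allEdges-sum n w′ (λ u v → w-sym (suc u) (suc v))) ⟩
  (w zero zero + A) + (∑ (λ u → w (suc u) zero) + ∑₂ w′)  ≡⟨ cong ((w zero zero + A) +_) (∑-distrib-+ (λ u → w (suc u) zero) (λ u → ∑ (w′ u))) ⟨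
  ∑₂ w                                                 ∎
  where
  open ≡-Reasoning
  w′ : Fin n → Fin n → ℕ
  w′ u v = w (suc u) (suc v)
  star : List (Edge (suc n))
  star = tabulate (λ v → edge zero (suc v) (s≤s z≤n))
  A B D : ℕ
  A = ∑ (λ v → w zero (suc v))
  B = sum (map (onEdge w′) (allEdges n))
  D = ∑ (λ u → w′ u u)
  split : sum (map (onEdge w) (star ++ map lift (allEdges n))) ≡ A + B
  split = begin
    sum (map (onEdge w) (star ++ map lift (allEdges n)))                     ≡⟨ cong sum (map-++ (onEdge w) star _) ⟩
    sum (map (onEdge w) star ++ map (onEdge w) (map lift (allEdges n)))      ≡⟨ sum-++ (map (onEdge w) star) _ ⟩
    sum (map (onEdge w) star) + sum (map (onEdge w) (map lift (allEdges n))) ≡⟨ cong₂ (λ xs ys → sum xs + sum ys)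
                                                                                 (map-tabulate {n = n} _ (onEdge w)) (sym (map-∘ (allEdges n))) ⟩
    sum (tabulate {n = n} (λ v → w zero (suc v))) + B                                ≡⟨ cong (_+ B) (sum-tabulate {n} _) ⟩
    A + B                                                                    ∎
  regroup : ∀ a b c d → 2 * (a + b) + (c + d) ≡ (c + a) + (a + (2 * b + d))
  regroup = solve-∀

module _ {A : Set} (p : A → Bool) where

  sum-filter : ∀ (w : A → ℕ) xs → sum (map w (filter (T? ∘ p) xs)) ≡ sum (map (λ x → ι (p x) * w x) xs)
  sum-filter w []       = refl
  sum-filter w (x ∷ xs) with p x
  ... | true  = cong₂ _+_ (sym (+-identityʳ (w x))) (sum-filter w xs)
  ... | false = sum-filter w xs

  filter-split : ∀ xs → xs ↭ filter (T? ∘ p) xs ++ filter (T? ∘ not ∘ p) xs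
  filter-split []       = ↭-refl
  filter-split (x ∷ xs) with p x
  ... | true  = ↭-prep x (filter-split xs)
  ... | false = ↭-trans (↭-prep x (filter-split xs)) (↭-sym (shift x (filter (T? ∘ p) xs) _))

edgesOf : ∀ {n} → (Fin n → Fin n → Bool) → List (Edge n)
edgesOf g = filter (T? ∘ onEdge g) (allEdges _)

edgesOf-unique : ∀ {n} (g : Fin n → Fin n → Bool) → Unique (edgesOf g)
edgesOf-unique g = Uniqueₚ.filter⁺ (T? ∘ onEdge g) (allEdges-unique _)

edgesOf-sum : ∀ {n} (g : Fin n → Fin n → Bool) (w : Fin n → Fin n → ℕ) →
              Symmetric₂ g → (∀ u → g u u ≡ false) → Symmetric₂ w →
              2 * sum (map (onEdge w) (edgesOf g)) ≡ ∑₂ (λ u v → ι (g u v) * w u v)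
edgesOf-sum {n} g w g-sym g-irrefl w-sym = begin
  2 * sum (map (onEdge w) (edgesOf g))                    ≡⟨ cong (2 *_) (sum-filter (onEdge g) (onEdge w) (allEdges n)) ⟩
  2 * sum (map (onEdge gw) (allEdges n))                  ≡⟨ +-identityʳ _ ⟨
  2 * sum (map (onEdge gw) (allEdges n)) + 0              ≡⟨ cong (2 * sum (map (onEdge gw) (allEdges n)) +_) loops ⟨
  2 * sum (map (onEdge gw) (allEdges n)) + ∑ (λ u → gw u u) ≡⟨ allEdges-sum n gw (λ u v → cong₂ (λ b c → ι b * c) (g-sym u v) (w-sym u v)) ⟩
  ∑₂ gw                                                   ∎
  where
  open ≡-Reasoning
  gw : Fin n → Fin n → ℕ
  gw u v = ι (g u v) * w u v
  loops : ∑ (λ u → gw u u) ≡ 0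
  loops = trans (sum-cong-≗ (λ u → cong (λ b → ι b * w u u) (g-irrefl u))) (trans (∑-const n 0) (*-zeroʳ n))

-- The cost in terms of the complement

-- The edges are the pairs of distinct vertices outside H; tested against all symmetric weights, no edge lists need be compared.
ComplementOf : ∀ {n} → (Fin n → Fin n → Bool) → List (Edge n) → Set
ComplementOf H edges = ∀ w → Symmetric₂ w →
  2 * sum (map (onEdge w) edges) + ∑ (λ u → w u u) + ∑₂ (λ u v → ι (H u v) * w u v) ≡ ∑₂ w

does-ι : ∀ {A : Set} (a? : Dec A) → A → ι (does a?) ≡ 1
does-ι a? a = cong ι (dec-true a? a)

does-ι-no : ∀ {A : Set} (a? : Dec A) → ¬ A → ι (does a?) ≡ 0
does-ι-no a? ¬a = cong ι (dec-false a? ¬a)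

off-diagonal : ∀ {n} {u v z : Fin n} → ¬ (u ≡ v × v ≡ z) → δ u v * (δ v z * 1) ≡ 0
off-diagonal {u = u} {v} {z} ¬diag with u ≟ v | v ≟ z
... | yes u≡v | yes v≡z = contradiction (u≡v , v≡z) ¬diag
... | yes _   | no  _   = refl
... | no  _   | _       = refl

≢⇒==-false : ∀ {b c} → b ≢ c → (b == c) ≡ false
≢⇒==-false {true}  {true}  b≢c = contradiction refl b≢c
≢⇒==-false {true}  {false} _   = refl
≢⇒==-false {false} {true}  _   = refl
≢⇒==-false {false} {false} b≢c = contradiction refl b≢c

separated : ∀ {n} → (Fin n → Bool) → Fin n → Fin n → Fin n → Bool
separated U u v z = (U u == U v) ∧ (U u xor U z)

-- How much less than n|H| the ordered pairs of H contribute when the root split is U and each part is the join of every pair inside it.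
cutLoss : ∀ {n} → (Fin n → Fin n → Bool) → (Fin n → Bool) → ℕ
cutLoss H U = ∑₃ (λ u v z → ι (H u v) * ι (separated U u v z))

module _ {n : ℕ} (G : Graph n) (H : Fin n → Fin n → Bool) (comp : ComplementOf H (Graph.edges G))
         (T : HCTree n) where

  private
    t : Tree n
    t = HCTree.tree T

    every : ∀ v → v ∈ leaves t
    every v = ∈-resp-↭ (↭-sym (HCTree.leaves-biject-V T)) (∈-allFin v)

    unique : Unique (leaves t)
    unique = Unique-resp-↭ (↭-sym (HCTree.leaves-biject-V T)) (Uniqueₚ.allFin⁺ n)

    distinct : Distinct t
    distinct = Unique⇒Distinct t unique

    W? : ∀ u v z → Dec (Below t u v z)
    W? u v z = z ∈? leaves (lca t u v)

    W : Fin n → Fin n → Fin n → ℕ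
    W u v z = ι (does (W? u v z))

    W≤1 : ∀ u v z → W u v z ≤ 1
    W≤1 u v z = ι≤1 (does (W? u v z))

    size : Fin n → Fin n → ℕ
    size u v = length (leaves (lca t u v))

    size≡∑W : ∀ u v → size u v ≡ ∑ (W u v)
    size≡∑W u v = length-unique (lca-unique t unique)

    -- The complement identity is applied to the weight `size`: every diagonal entry is a single
    -- leaf, giving `n`, and every other size is expanded into a count of the `z` below the join.
    cost-identity : 2 * cost G T + n + ∑₃ (λ u v z → ι (H u v) * W u v z) ≡ ∑₃ W
    cost-identity = begin
      2 * cost G T + n + ∑₃ (λ u v z → ι (H u v) * W u v z)
        ≡⟨ cong₂ (λ a b → 2 * cost G T + a + b) loops H-part ⟨
      2 * cost G T + ∑ (λ u → size u u) + ∑₂ (λ u v → ι (H u v) * size u v)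
        ≡⟨ comp size (λ u v → cong (length ∘ leaves) (lca-comm t distinct (every u) (every v))) ⟩
      ∑₂ size
        ≡⟨ ∑₂-cong size≡∑W ⟩
      ∑₃ W ∎
      where
      open ≡-Reasoning
      loops : ∑ (λ u → size u u) ≡ n
      loops = trans (sum-cong-≗ (λ u → cong length (lca-diag t distinct (every u)))) (trans (∑-const n 1) (*-identityʳ n))
      H-part : ∑₂ (λ u v → ι (H u v) * size u v) ≡ ∑₃ (λ u v z → ι (H u v) * W u v z)
      H-part = ∑₂-cong (λ u v → trans (cong (ι (H u v) *_) (size≡∑W u v)) (sym (*-distribˡ-∑ (ι (H u v)) (W u v))))

    h : ℕ
    h = ∑₂ (λ u v → ι (H u v))

  -- A separated triple over a pair of `H` is paid for in one of two ways: either `z` is not below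
  -- the join, so the pair earns less, or it is and the triple is a surplus. `M` leaves the
  -- separated triples out and still has two per triple, so the surplus is free to pay.
  cost-lower-bound : ∀ {a b : Fin n} → a ≢ b → ∃ λ (U : Fin n → Bool) → (∃₂ λ u v → U u ≢ U v) ×
    2 * (n * (n * n)) + n + 3 * cutLoss H U ≤ 3 * (2 * cost G T + n + n * h)
  cost-lower-bound a≢b with root-cut t distinct (every _) (every _) a≢b
  ... | U , nontrivial , cut = U , nontrivial , (begin
    2 * (n * (n * n)) + n + 3 * cutLoss H U          ≡⟨ cong (_+ 3 * cutLoss H U) (∑₃-diagonal {n}) ⟨
    ∑₃ {n} (λ u v z → 2 + δ u v * (δ v z * 1)) + 3 * cutLoss H U  ≤⟨ +-monoˡ-≤ _ (∑₃-mono {n} two) ⟩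
    ∑₃ (λ u v z → M u v z + (M u z v + M v z u)) + 3 * cutLoss H U ≡⟨ cong (_+ 3 * cutLoss H U) (∑₃-rotations M) ⟩
    3 * ∑₃ M + 3 * cutLoss H U                       ≡⟨ *-distribˡ-+ 3 (∑₃ M) _ ⟨
    3 * (∑₃ M + cutLoss H U)                         ≤⟨ *-monoʳ-≤ 3 (+-cancelʳ-≤ (∑₃ HW) _ _ summed) ⟩
    3 * (2 * cost G T + n + n * h)                   ∎)
    where
    open ≤-Reasoning
    M HW : Fin n → Fin n → Fin n → ℕ
    M u v z = W u v z * ι (not (separated U u v z))
    HW u v z = ι (H u v) * W u v z

    -- Here `b` stands for the pair lying in `H`, `c` for `z` being below the join, `d` for
    -- separation. The right side exceeds the left by `c` or by `b`, minus the product of the two.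
    trade : ∀ b c d → ι c * ι (not d) + ι b * ι d + ι b * ι c ≤ ι c + ι b
    trade true  true  true  = ≤-refl
    trade true  true  false = ≤-refl
    trade true  false true  = ≤-refl
    trade true  false false = z≤n
    trade false true  true  = z≤n
    trade false true  false = ≤-refl
    trade false false true  = z≤n
    trade false false false = z≤n

    summed : ∑₃ M + cutLoss H U + ∑₃ HW ≤ 2 * cost G T + n + n * h + ∑₃ HW
    summed = begin
      ∑₃ M + cutLoss H U + ∑₃ HW
        ≡⟨ trans (∑₃-+ _ HW) (cong (_+ ∑₃ HW) (∑₃-+ M _)) ⟨
      ∑₃ (λ u v z → M u v z + ι (H u v) * ι (separated U u v z) + HW u v z)
        ≤⟨ ∑₃-mono (λ u v z → trade (H u v) (does (W? u v z)) (separated U u v z)) ⟩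
      ∑₃ (λ u v z → W u v z + ι (H u v))
        ≡⟨ trans (∑₃-+ W _) (cong (∑₃ W +_) (∑₃-ignore {n} (λ u v → ι (H u v)))) ⟩
      ∑₃ W + n * h
        ≡⟨ cong (_+ n * h) cost-identity ⟨
      2 * cost G T + n + ∑₃ HW + n * h
        ≡⟨ swap-last (2 * cost G T + n) (∑₃ HW) (n * h) ⟩
      2 * cost G T + n + n * h + ∑₃ HW ∎
      where
      swap-last : ∀ a b c → a + b + c ≡ a + c + b
      swap-last = solve-∀

    one : ∀ u v z → Below t u v z → separated U u v z ≡ false → M u v z ≡ 1
    one u v z below unsep = cong₂ (λ a b → a * ι (not b)) (does-ι (W? u v z) below) unsep

    unseparated : ∀ {u v z} → U u ≡ U z → separated U u v z ≡ false
    unseparated {u} {v} {z} Uu≡Uz rewrite Uu≡Uz = trans (cong ((U z == U v) ∧_) (xor-same (U z))) (∧-zeroʳ _)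

    across : ∀ u v z → U u ≢ U v → M u v z ≡ 1
    across u v z Uu≢Uv = one u v z (cut (every u) (every v) (every z) Uu≢Uv)
      (cong (_∧ (U u xor U z)) (≢⇒==-false Uu≢Uv))

    -- If `U` splits the triple, exactly two of its pairs go across and each of these counts. If
    -- not, nothing is separated and `below-two` applies, with all three pairs counting on the
    -- diagonal.
    two : ∀ u v z → 2 + δ u v * (δ v z * 1) ≤ M u v z + (M u z v + M v z u)
    two u v z with U u ≟ᵇ U v | U u ≟ᵇ U z
    ... | no Uu≢Uv  | yes Uu≡Uz
      rewrite off-diagonal {u = u} {v} {z} (Uu≢Uv ∘ cong U ∘ proj₁)
            | across u v z Uu≢Uv | across v z u (λ Uv≡Uz → Uu≢Uv (trans Uu≡Uz (sym Uv≡Uz))) =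
        s≤s (m≤n+m 1 _)
    ... | no Uu≢Uv  | no Uu≢Uz
      rewrite off-diagonal {u = u} {v} {z} (Uu≢Uv ∘ cong U ∘ proj₁)
            | across u v z Uu≢Uv | across u z v Uu≢Uz =
        s≤s (s≤s z≤n)
    ... | yes Uu≡Uv | no Uu≢Uz
      rewrite off-diagonal {u = u} {v} {z} (λ (u≡v , v≡z) → Uu≢Uz (cong U (trans u≡v v≡z)))
            | across u z v Uu≢Uz | across v z u (λ Uv≡Uz → Uu≢Uz (trans Uu≡Uv Uv≡Uz)) =
        m≤n+m 2 _
    ... | yes Uu≡Uv | yes Uu≡Uz with (u ≟ v) ×-dec (v ≟ z)
    ...   | yes (refl , refl)
      rewrite one u u u (lca-∋ˡ t (every u)) (unseparated Uu≡Uz) | does-ι (u ≟ u) refl = ≤-refl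
    ...   | no ¬diag rewrite off-diagonal {u = u} {v} {z} ¬diag
            with below-two t distinct (every u) (every v) (every z)
    ...     | inj₁ (uv , uz)
              rewrite one u v z uv (unseparated Uu≡Uz) | one u z v uz (unseparated Uu≡Uv) =
                s≤s (s≤s z≤n)
    ...     | inj₂ (inj₁ (uv , vz))
              rewrite one u v z uv (unseparated Uu≡Uz) | one v z u vz (unseparated (sym Uu≡Uv)) =
                s≤s (m≤n+m 1 _)
    ...     | inj₂ (inj₂ (uz , vz))
              rewrite one u z v uz (unseparated Uu≡Uv) | one v z u vz (unseparated (sym Uu≡Uv)) =
                m≤n+m 2 _

  -- The two inequalities of the lower bound reverse: `resolved` charges each vertex missing below
  -- the join of a pair of `H` to `cutLoss`, and arity two caps what each triple contributes.
  cost-upper-bound : Binary t → ∀ U → (∀ {u v z} → H u v ≡ true → Below t u v z ⊎ separated U u v z ≡ true) →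
    3 * (2 * cost G T + n + n * h) ≤ 2 * (n * (n * n)) + n + 3 * cutLoss H U
  cost-upper-bound binary U resolved = begin
    3 * (2 * cost G T + n + n * h)              ≤⟨ *-monoʳ-≤ 3 (+-monoʳ-≤ (2 * cost G T + n) H-pairs) ⟩
    3 * (2 * cost G T + n + (∑₃ HW + cutLoss H U)) ≡⟨ cong (3 *_) (+-assoc (2 * cost G T + n) _ _) ⟨
    3 * (2 * cost G T + n + ∑₃ HW + cutLoss H U) ≡⟨ cong (λ s → 3 * (s + cutLoss H U)) cost-identity ⟩
    3 * (∑₃ W + cutLoss H U)                    ≡⟨ *-distribˡ-+ 3 (∑₃ W) _ ⟩
    3 * ∑₃ W + 3 * cutLoss H U                  ≡⟨ cong (_+ 3 * cutLoss H U) (∑₃-rotations W) ⟨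
    ∑₃ (λ u v z → W u v z + (W u z v + W v z u)) + 3 * cutLoss H U ≤⟨ +-monoˡ-≤ _ (∑₃-mono {n} at-most-two) ⟩
    ∑₃ {n} (λ u v z → 2 + δ u v * (δ v z * 1)) + 3 * cutLoss H U  ≡⟨ cong (_+ 3 * cutLoss H U) (∑₃-diagonal {n}) ⟩
    2 * (n * (n * n)) + n + 3 * cutLoss H U     ∎
    where
    open ≤-Reasoning
    HW : Fin n → Fin n → Fin n → ℕ
    HW u v z = ι (H u v) * W u v z

    lost : ∀ u v z → ι (H u v) ≤ HW u v z + ι (H u v) * ι (separated U u v z)
    lost u v z with H u v in Huv
    ... | false = z≤n
    ... | true  with resolved {u} {v} {z} Huv
    ...   | inj₁ below rewrite does-ι (W? u v z) below = s≤s z≤n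
    ...   | inj₂ sep   rewrite sep = m≤n+m 1 _

    H-pairs : n * h ≤ ∑₃ HW + cutLoss H U
    H-pairs = begin
      n * h                                                          ≡⟨ ∑₃-ignore {n} (λ u v → ι (H u v)) ⟨
      ∑₃ (λ u v z → ι (H u v))                                       ≤⟨ ∑₃-mono lost ⟩
      ∑₃ (λ u v z → HW u v z + ι (H u v) * ι (separated U u v z))    ≡⟨ ∑₃-+ HW _ ⟩
      ∑₃ HW + cutLoss H U                                            ∎

    at-most-two : ∀ u v z → W u v z + (W u z v + W v z u) ≤ 2 + δ u v * (δ v z * 1)
    at-most-two u v z with below-not-all t distinct binary (every u) (every v) (every z)
    ... | inj₁ (u≡v , v≡z) rewrite does-ι (u ≟ v) u≡v | does-ι (v ≟ z) v≡z =
      +-mono-≤ (W≤1 u v z) (+-mono-≤ (W≤1 u z v) (W≤1 v z u))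
    ... | inj₂ (inj₁ ¬uv) rewrite does-ι-no (W? u v z) ¬uv =
      ≤-trans (+-mono-≤ (W≤1 u z v) (W≤1 v z u)) (m≤m+n 2 _)
    ... | inj₂ (inj₂ (inj₁ ¬uz)) rewrite does-ι-no (W? u z v) ¬uz =
      ≤-trans (+-mono-≤ (W≤1 u v z) (W≤1 v z u)) (m≤m+n 2 _)
    ... | inj₂ (inj₂ (inj₂ ¬vz)) rewrite does-ι-no (W? v z u) ¬vz =
      ≤-trans (+-mono-≤ (W≤1 u v z) (+-monoˡ-≤ 0 (W≤1 u z v))) (m≤m+n 2 _)

-- A binary tree made of two caterpillars

module _ {n : ℕ} where

  cat-below : ∀ {x : Fin n} {xs u v z} → Unique (x ∷ xs) →
              u ∈ x ∷ xs → v ∈ x ∷ xs → z ∈ x ∷ xs → u ≢ v → u ≡ x ⊎ v ≡ x → Below (cat x xs) u v z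
  cat-below {x} {xs} {u} {v} {z} xs! u∈ v∈ z∈ u≢v = [ (λ { refl → head v∈ u≢v }) , (λ { refl → flipped (head u∈ (u≢v ∘ sym)) }) ]′
    where
    in-cat : ∀ {w} → w ∈ x ∷ xs → w ∈ leaves (cat x xs)
    in-cat w∈ = subst (_ ∈_) (sym (leaves-cat x xs)) w∈
    head : ∀ {w} → w ∈ x ∷ xs → x ≢ w → Below (cat x xs) x w z
    head (here w≡x)  x≢w = contradiction (sym w≡x) x≢w
    head (there w∈′) _   = subst (λ s → z ∈ leaves s) (sym (lca-cat-head x xs xs! w∈′)) (in-cat z∈)
    flipped : Below (cat x xs) v u z → Below (cat x xs) u v z
    flipped = subst (λ s → z ∈ leaves s) (lca-comm (cat x xs)
      (Unique⇒Distinct (cat x xs) (subst Unique (sym (leaves-cat x xs)) xs!)) (in-cat v∈) (in-cat u∈))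

  module _ (side : Fin n → Bool) {a b : Fin n} (a-true : side a ≡ true) (b-false : side b ≡ false) where

    private
      -- Brings the hub of the star to the front, where it can head the caterpillar.
      part : ∀ (p : Fin n → Bool) {x} → p x ≡ true →
             ∃ λ xs → x ∷ xs ↭ filter (T? ∘ p) (allFin n)
      part p {x} px with ∈-∃++ (∈-filter⁺ (T? ∘ p) (∈-allFin x) (Equivalence.from T-≡ px))
      ... | ys , zs , eq = ys ++ zs , ↭-trans (↭-sym (shift x ys zs)) (↭-reflexive (sym eq))

      as bs : List (Fin n)
      as = proj₁ (part side a-true)
      bs = proj₁ (part (not ∘ side) (cong not b-false))

      in-as : ∀ {z} → side z ≡ true → z ∈ a ∷ as
      in-as z-true = ∈-resp-↭ (↭-sym (proj₂ (part side a-true)))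
        (∈-filter⁺ (T? ∘ side) (∈-allFin _) (Equivalence.from T-≡ z-true))

      in-bs : ∀ {z} → side z ≡ false → z ∈ b ∷ bs
      in-bs z-false = ∈-resp-↭ (↭-sym (proj₂ (part (not ∘ side) (cong not b-false))))
        (∈-filter⁺ (T? ∘ not ∘ side) (∈-allFin _) (Equivalence.from T-≡ (cong not z-false)))

      t : Tree n
      t = node₂ (cat a as) (cat b bs)

      leaves-t : leaves t ↭ allFin n
      leaves-t = ↭-trans
        (↭-reflexive (trans (leaves-node₂ (cat a as) (cat b bs)) (cong₂ _++_ (leaves-cat a as) (leaves-cat b bs))))
        (↭-trans (++⁺ (proj₂ (part side a-true)) (proj₂ (part (not ∘ side) (cong not b-false))))
          (↭-sym (filter-split side (allFin n))))

      t! : Unique (leaves t)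
      t! = Unique-resp-↭ (↭-sym leaves-t) (Uniqueₚ.allFin⁺ n)

      parts! : Unique (a ∷ as) × Unique (b ∷ bs)
      parts! with Unique-++⁻ (leaves (cat a as)) (subst Unique (leaves-node₂ (cat a as) (cat b bs)) t!)
      ... | as! , bs! , _ = subst Unique (leaves-cat a as) as! , subst Unique (leaves-cat b bs) bs!

      d : Distinct t
      d = Unique⇒Distinct t t!

      leaf-a : ∀ {z} → side z ≡ true → z ∈ leaves (cat a as)
      leaf-a z-true = subst (_ ∈_) (sym (leaves-cat a as)) (in-as z-true)

      leaf-b : ∀ {z} → side z ≡ false → z ∈ leaves (cat b bs)
      leaf-b z-false = subst (_ ∈_) (sym (leaves-cat b bs)) (in-bs z-false)

      every : ∀ z → z ∈ leaves t
      every z = ∈-resp-↭ (↭-sym leaves-t) (∈-allFin z)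

    two-caterpillars : HCTree n
    two-caterpillars = record { tree = t ; leaves-biject-V = leaves-t }

    two-caterpillars-binary : Binary t
    two-caterpillars-binary = Binary-node₂ {l = cat a as} (Binary-cat a as) (Binary-cat b bs)

    -- Pairs across meet at the root. A pair inside a part contains the head of that part, because
    -- the other head lies on the other side, and so has the whole part below it.
    two-caterpillars-below : ∀ {u v z} → u ≢ v → (side u ≡ side v → (u ≡ a ⊎ v ≡ a) ⊎ (u ≡ b ⊎ v ≡ b)) →
                             Below t u v z ⊎ separated side u v z ≡ true
    two-caterpillars-below {u} {v} {z} u≢v heads with side u in su | side v in sv | side z in sz
    ... | true  | true  | false = inj₂ refl
    ... | false | false | true  = inj₂ refl
    ... | true  | false | _     =
      inj₁ (subst (λ s → z ∈ leaves s) (sym (lca-apart (pair (cat a as) (cat b bs)) d {zero} {suc zero} (λ ()) (leaf-a su) (leaf-b sv))) (every z))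
    ... | false | true  | _     =
      inj₁ (subst (λ s → z ∈ leaves s) (sym (lca-apart (pair (cat a as) (cat b bs)) d {suc zero} {zero} (λ ()) (leaf-b su) (leaf-a sv))) (every z))
    ... | true  | true  | true  =
      inj₁ (subst (λ s → z ∈ leaves s) (sym (lca-child (pair (cat a as) (cat b bs)) d {zero} (leaf-a su) (leaf-a sv)))
        (cat-below (proj₁ parts!) (in-as su) (in-as sv) (in-as sz) u≢v head-a))
      where
      head-a : u ≡ a ⊎ v ≡ a
      head-a with heads refl
      ... | inj₁ h           = h
      ... | inj₂ (inj₁ refl) = contradiction (trans (sym su) b-false) λ ()
      ... | inj₂ (inj₂ refl) = contradiction (trans (sym sv) b-false) λ ()
    ... | false | false | false =
      inj₁ (subst (λ s → z ∈ leaves s) (sym (lca-child (pair (cat a as) (cat b bs)) d {suc zero} (leaf-b su) (leaf-b sv)))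
        (cat-below (proj₂ parts!) (in-bs su) (in-bs sv) (in-bs sz) u≢v head-b))
      where
      head-b : u ≡ b ⊎ v ≡ b
      head-b with heads refl
      ... | inj₂ h           = h
      ... | inj₁ (inj₁ refl) = contradiction (trans (sym su) a-true) λ ()
      ... | inj₁ (inj₂ refl) = contradiction (trans (sym sv) a-true) λ ()

-- Counting and arithmetic for the losses of cuts

∑-split : ∀ a {b} (f : Fin (a + b) → ℕ) → ∑ f ≡ ∑ (λ i → f (i ↑ˡ b)) + ∑ (λ j → f (a ↑ʳ j))
∑-split zero    f = refl
∑-split (suc a) f = trans (cong (f zero +_) (∑-split a (f ∘ suc))) (sym (+-assoc (f zero) _ _))

∑-term : ∀ {n} (f : Fin n → ℕ) i → f i ≤ ∑ f
∑-term f zero    = m≤m+n _ _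
∑-term f (suc i) = ≤-trans (∑-term (f ∘ suc) i) (m≤n+m _ _)

-- Each `i` disagrees with `i₀` or with `i₁`, so some `z` is opposite to it. For opposite `i` and
-- `z`, any `j` agrees with exactly one of them, so exactly one of the triples `(i, j, z)` and
-- `(z, j, i)` is lost; hence the factor 2.
split-loss : ∀ {a b} (α : Fin a → Bool) (β : Fin b → Bool) {i₀ i₁} → α i₀ ≢ α i₁ →
             a * b ≤ 2 * ∑ (λ i → ∑ (λ j → ∑ (λ z → ι ((α i == β j) ∧ (α i xor α z)))))
split-loss {a} {b} α β {i₀} {i₁} α₀≢α₁ = begin
  a * b                                                  ≡⟨ ∑-const a b ⟨
  ∑ {a} (λ _ → b)                                        ≡⟨ sum-cong-≗ {a} (λ _ → trans (∑-const b 1) (*-identityʳ b)) ⟨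
  ∑ {a} (λ _ → ∑ {b} (λ _ → 1))                          ≤⟨ ∑-mono {a} (λ i → ∑-mono {b} (λ j → some-opposite i)) ⟩
  ∑ {a} (λ i → ∑ {b} (λ j → ∑ (λ z → ι (α i xor α z))))  ≡⟨ sum-cong-≗ {a} (λ i → sum-cong-≗ {b} (λ j → sum-cong-≗ {a} (λ z → pairing (α i) (β j) (α z)))) ⟩
  ∑ {a} (λ i → ∑ {b} (λ j → ∑ {a} (λ z → c i j z + c z j i)))
    ≡⟨ sum-cong-≗ {a} (λ i → trans (sum-cong-≗ {b} (λ j → ∑-distrib-+ {a} (c i j) (λ z → c z j i)))
         (∑-distrib-+ {b} (λ j → ∑ (c i j)) (λ j → ∑ (λ z → c z j i)))) ⟩
  ∑ {a} (λ i → ∑ (λ j → ∑ (c i j)) + ∑ (λ j → ∑ (λ z → c z j i)))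
    ≡⟨ ∑-distrib-+ {a} (λ i → ∑ (λ j → ∑ (c i j))) (λ i → ∑ (λ j → ∑ (λ z → c z j i))) ⟩
  S + ∑ {a} (λ i → ∑ {b} (λ j → ∑ {a} (λ z → c z j i)))  ≡⟨ cong (S +_) exchange ⟩
  S + S                                                  ≡⟨ cong (S +_) (+-identityʳ S) ⟨
  2 * S                                                  ∎
  where
  open ≤-Reasoning
  c : Fin a → Fin b → Fin a → ℕ
  c i j z = ι ((α i == β j) ∧ (α i xor α z))
  S : ℕ
  S = ∑ (λ i → ∑ (λ j → ∑ (c i j)))
  pairing : ∀ p q r → ι (p xor r) ≡ ι ((p == q) ∧ (p xor r)) + ι ((r == q) ∧ (r xor p))
  pairing true  true  true  = refl
  pairing true  true  false = refl
  pairing true  false true  = refl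
  pairing true  false false = refl
  pairing false true  true  = refl
  pairing false true  false = refl
  pairing false false true  = refl
  pairing false false false = refl
  xor-≢ : ∀ {p q} → p ≢ q → 1 ≤ ι (p xor q)
  xor-≢ {true}  {true}  p≢q = contradiction refl p≢q
  xor-≢ {true}  {false} _   = ≤-refl
  xor-≢ {false} {true}  _   = ≤-refl
  xor-≢ {false} {false} p≢q = contradiction refl p≢q
  some-opposite : ∀ i → 1 ≤ ∑ (λ z → ι (α i xor α z))
  some-opposite i with α i ≟ᵇ α i₀
  ... | no  αᵢ≢α₀ = ≤-trans (xor-≢ αᵢ≢α₀) (∑-term _ i₀)
  ... | yes αᵢ≡α₀ = ≤-trans (xor-≢ (λ αᵢ≡α₁ → α₀≢α₁ (trans (sym αᵢ≡α₀) αᵢ≡α₁))) (∑-term _ i₁)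
  exchange : ∑ {a} (λ i → ∑ {b} (λ j → ∑ {a} (λ z → c z j i))) ≡ S
  exchange = trans (∑-comm {a} {b} (λ i j → ∑ (λ z → c z j i)))
    (trans (sum-cong-≗ {b} (λ j → ∑-comm {a} {a} (λ i z → c z j i))) (∑-comm {b} {a} (λ j z → ∑ (c z j))))

module _ {n : ℕ} where

  ∑₂-pickˡ : ∀ (c : Fin n) (F : Fin n → Fin n → ℕ) → ∑₂ (λ u v → δ u c * F u v) ≡ ∑ (F c)
  ∑₂-pickˡ c F = trans (sum-cong-≗ {n} (λ u → *-distribˡ-∑ (δ u c) (F u))) (∑-δ c (λ u → ∑ (F u)))

  ∑₂-pickʳ : ∀ (c : Fin n) (F : Fin n → Fin n → ℕ) → ∑₂ (λ u v → δ v c * F u v) ≡ ∑ (λ u → F u c)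
  ∑₂-pickʳ c F = sum-cong-≗ {n} (λ u → ∑-δ c (F u))

-- The two values of the queried bit shift the equation for the optimum by `6 * n`, so they cannot
-- be confused on a nonempty vertex set.
gap : ∀ n s → s + 3 * (2 * n * 1) ≡ s + 3 * (2 * n * 0) → n ≡ 0
gap n s eq = *-cancelˡ-≡ n 0 6 (trans (regroup n) (trans (+-cancelˡ-≡ s _ _ eq) (vanish n)))
  where
  regroup : ∀ n → 6 * n ≡ 3 * (2 * n * 1)
  regroup = solve-∀
  vanish : ∀ n → 3 * (2 * n * 0) ≡ 6 * 0
  vanish = solve-∀

weaken-cost : ∀ r c n h h′ b → r ≤ c → h ≡ h′ → 3 * (2 * c + n + n * h) ≤ b → 3 * (2 * r + n + n * h′) ≤ b
weaken-cost r c n h _ b r≤c refl bound = ≤-trans (*-monoʳ-≤ 3 (+-monoˡ-≤ (n * h) (+-monoˡ-≤ n (*-monoʳ-≤ 2 r≤c)))) bound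

weaken-loss : ∀ r c n h h′ b l l′ → c ≡ r → h ≡ h′ → l ≤ l′ → b + 3 * l′ ≤ 3 * (2 * c + n + n * h) →
              b + 3 * l ≤ 3 * (2 * r + n + n * h′)
weaken-loss r _ n h _ b l l′ refl refl l≤l′ bound = ≤-trans (+-monoʳ-≤ b (*-monoʳ-≤ 3 l≤l′)) bound

combine-bounds : ∀ b s l d e → s ≤ b + 3 * l → b + 3 * l ≤ s → l + d ≡ e → s + 3 * d ≡ b + 3 * e
combine-bounds b s l d _ s≤ ≤s refl = trans (cong (_+ 3 * d) (≤-antisym s≤ ≤s)) (collect b l d)
  where
  collect : ∀ b l d → b + 3 * l + 3 * d ≡ b + 3 * (l + d)
  collect = solve-∀

-- Used with `l` the loss of the intended cut, `l′` that of a competitor, and `m` the number of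
-- pairs between the two pad classes.
half-bound : ∀ l d e m l′ → l + d ≡ e → 2 * e ≤ m → m ≤ 2 * l′ → l ≤ l′
half-bound l d _ m l′ refl 2e≤m m≤2l′ = ≤-trans (m≤m+n l d) (*-cancelˡ-≤ 2 (≤-trans 2e≤m m≤2l′))

-- The gadget

-- The superscript of a pad is the side of the intended cut on which it lies.
data Vertex (k D E : ℕ) : Set where
  left right : Bool → Fin k → Vertex k D E
  padᶠ       : Fin D → Vertex k D E
  padᵗ       : Fin E → Vertex k D E

module Gadget (k D E : ℕ) where

  n : ℕ
  n = k + (k + (k + (k + (D + E))))

  V : Set
  V = Vertex k D E

  encode : V → Fin n
  encode (left  false i) = i ↑ˡ _
  encode (left  true  i) = k ↑ʳ (i ↑ˡ _)
  encode (right false j) = k ↑ʳ (k ↑ʳ (j ↑ˡ _))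
  encode (right true  j) = k ↑ʳ (k ↑ʳ (k ↑ʳ (j ↑ˡ _)))
  encode (padᶠ q)        = k ↑ʳ (k ↑ʳ (k ↑ʳ (k ↑ʳ (q ↑ˡ _))))
  encode (padᵗ p)        = k ↑ʳ (k ↑ʳ (k ↑ʳ (k ↑ʳ (D ↑ʳ p))))

  decode : Fin n → V
  decode = [ left false , [ left true , [ right false , [ right true , [ padᶠ , padᵗ ]′ ∘ splitAt D ]′
    ∘ splitAt k ]′ ∘ splitAt k ]′ ∘ splitAt k ]′ ∘ splitAt k

  decode-encode : ∀ a → decode (encode a) ≡ a
  decode-encode (left false i) rewrite splitAt-↑ˡ k i (k + (k + (k + (D + E)))) = refl
  decode-encode (left true i)
    rewrite splitAt-↑ʳ k (k + (k + (k + (D + E)))) (i ↑ˡ (k + (k + (D + E))))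
          | splitAt-↑ˡ k i (k + (k + (D + E))) = refl
  decode-encode (right false j)
    rewrite splitAt-↑ʳ k (k + (k + (k + (D + E)))) (k ↑ʳ (j ↑ˡ (k + (D + E))))
          | splitAt-↑ʳ k (k + (k + (D + E))) (j ↑ˡ (k + (D + E)))
          | splitAt-↑ˡ k j (k + (D + E)) = refl
  decode-encode (right true j)
    rewrite splitAt-↑ʳ k (k + (k + (k + (D + E)))) (k ↑ʳ (k ↑ʳ (j ↑ˡ (D + E))))
          | splitAt-↑ʳ k (k + (k + (D + E))) (k ↑ʳ (j ↑ˡ (D + E)))
          | splitAt-↑ʳ k (k + (D + E)) (j ↑ˡ (D + E))
          | splitAt-↑ˡ k j (D + E) = refl
  decode-encode (padᶠ q)
    rewrite splitAt-↑ʳ k (k + (k + (k + (D + E)))) (k ↑ʳ (k ↑ʳ (k ↑ʳ (q ↑ˡ E))))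
          | splitAt-↑ʳ k (k + (k + (D + E))) (k ↑ʳ (k ↑ʳ (q ↑ˡ E)))
          | splitAt-↑ʳ k (k + (D + E)) (k ↑ʳ (q ↑ˡ E))
          | splitAt-↑ʳ k (D + E) (q ↑ˡ E)
          | splitAt-↑ˡ D q E = refl
  decode-encode (padᵗ p)
    rewrite splitAt-↑ʳ k (k + (k + (k + (D + E)))) (k ↑ʳ (k ↑ʳ (k ↑ʳ (D ↑ʳ p))))
          | splitAt-↑ʳ k (k + (k + (D + E))) (k ↑ʳ (k ↑ʳ (D ↑ʳ p)))
          | splitAt-↑ʳ k (k + (D + E)) (k ↑ʳ (D ↑ʳ p))
          | splitAt-↑ʳ k (D + E) (D ↑ʳ p)
          | splitAt-↑ʳ D E p = refl

  encode-decode : ∀ u → encode (decode u) ≡ u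
  encode-decode u with splitAt k u in e₁
  ... | inj₁ i = splitAt⁻¹-↑ˡ e₁
  ... | inj₂ u₁ with splitAt k u₁ in e₂
  ...   | inj₁ i = trans (cong (k ↑ʳ_) (splitAt⁻¹-↑ˡ e₂)) (splitAt⁻¹-↑ʳ e₁)
  ...   | inj₂ u₂ with splitAt k u₂ in e₃
  ...     | inj₁ j = trans (cong (k ↑ʳ_) (trans (cong (k ↑ʳ_) (splitAt⁻¹-↑ˡ e₃)) (splitAt⁻¹-↑ʳ e₂))) (splitAt⁻¹-↑ʳ e₁)
  ...     | inj₂ u₃ with splitAt k u₃ in e₄
  ...       | inj₁ j = trans (cong (k ↑ʳ_) (trans (cong (k ↑ʳ_) (trans (cong (k ↑ʳ_)
                (splitAt⁻¹-↑ˡ e₄)) (splitAt⁻¹-↑ʳ e₃))) (splitAt⁻¹-↑ʳ e₂))) (splitAt⁻¹-↑ʳ e₁)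
  ...       | inj₂ u₄ with splitAt D u₄ in e₅
  ...         | inj₁ q = trans (cong (k ↑ʳ_) (trans (cong (k ↑ʳ_) (trans (cong (k ↑ʳ_) (trans (cong (k ↑ʳ_)
                  (splitAt⁻¹-↑ˡ e₅)) (splitAt⁻¹-↑ʳ e₄))) (splitAt⁻¹-↑ʳ e₃))) (splitAt⁻¹-↑ʳ e₂))) (splitAt⁻¹-↑ʳ e₁)
  ...         | inj₂ p = trans (cong (k ↑ʳ_) (trans (cong (k ↑ʳ_) (trans (cong (k ↑ʳ_) (trans (cong (k ↑ʳ_)
                  (splitAt⁻¹-↑ʳ e₅)) (splitAt⁻¹-↑ʳ e₄))) (splitAt⁻¹-↑ʳ e₃))) (splitAt⁻¹-↑ʳ e₂))) (splitAt⁻¹-↑ʳ e₁)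

  ∑ᵥ : (V → ℕ) → ℕ
  ∑ᵥ F = ∑ (F ∘ left false) + (∑ (F ∘ left true) + (∑ (F ∘ right false)
    + (∑ (F ∘ right true) + (∑ (F ∘ padᶠ) + ∑ (F ∘ padᵗ)))))

  ∑-encode : ∀ (g : Fin n → ℕ) → ∑ g ≡ ∑ᵥ (g ∘ encode)
  ∑-encode g = trans (∑-split k g) (cong (∑ (g ∘ encode ∘ left false) +_)
    (trans (∑-split k _) (cong (∑ (g ∘ encode ∘ left true) +_)
      (trans (∑-split k _) (cong (∑ (g ∘ encode ∘ right false) +_)
        (trans (∑-split k _) (cong (∑ (g ∘ encode ∘ right true) +_) (∑-split D _))))))))

  ∑-decode : ∀ (F : V → ℕ) → ∑ (F ∘ decode) ≡ ∑ᵥ F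
  ∑-decode F = trans (∑-encode (F ∘ decode)) (cong₂ _+_ (block (left false)) (cong₂ _+_ (block (left true))
    (cong₂ _+_ (block (right false)) (cong₂ _+_ (block (right true)) (cong₂ _+_ (block padᶠ) (block padᵗ))))))
    where
    block : ∀ {m} (f : Fin m → V) → ∑ (F ∘ decode ∘ encode ∘ f) ≡ ∑ (F ∘ f)
    block f = sum-cong-≗ (λ i → cong F (decode-encode (f i)))

  ∑-pads≤ : ∀ (g : Fin n → ℕ) → ∑ (g ∘ encode ∘ padᶠ) + ∑ (g ∘ encode ∘ padᵗ) ≤ ∑ g
  ∑-pads≤ g = ≤-trans (last-block (∑ (g ∘ encode ∘ left false)) (∑ (g ∘ encode ∘ left true))
      (∑ (g ∘ encode ∘ right false)) (∑ (g ∘ encode ∘ right true)) _)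
    (≤-reflexive (sym (∑-encode g)))
    where
    last-block : ∀ a b c d e → e ≤ a + (b + (c + (d + e)))
    last-block a b c d e = ≤-trans (m≤n+m e d) (≤-trans (m≤n+m _ c) (≤-trans (m≤n+m _ b) (m≤n+m _ a)))

  ∑-padᶠ≤ : ∀ (g : Fin n → ℕ) → ∑ (g ∘ encode ∘ padᶠ) ≤ ∑ g
  ∑-padᶠ≤ g = ≤-trans (m≤m+n _ (∑ (g ∘ encode ∘ padᵗ))) (∑-pads≤ g)

  ∑-padᵗ≤ : ∀ (g : Fin n → ℕ) → ∑ (g ∘ encode ∘ padᵗ) ≤ ∑ g
  ∑-padᵗ≤ g = ≤-trans (m≤n+m _ (∑ (g ∘ encode ∘ padᶠ))) (∑-pads≤ g)

  -- Alice's bipartite graph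

  crossing : V → V → Bool
  crossing (left _ _)  (right _ _) = true
  crossing (right _ _) (left _ _)  = true
  crossing _           _           = false

  -- For each j, a left vertex has exactly one of the two right vertices with index j as a neighbour, and vice versa:
  -- neither the degrees nor the number of Alice's edges depend on the bits.
  aliceH : Vec Bool (k * k) → V → V → Bool
  aliceH x (left s i)  (right t j) = lookup x (combine i j) xor (s xor t)
  aliceH x (right t j) (left s i)  = lookup x (combine i j) xor (s xor t)
  aliceH x _           _           = false

  -- Input edges are the pairs outside `H`. Alice decides the pairs between left and right, Bob all
  -- the others.
  aliceEdge : Vec Bool (k * k) → Fin n → Fin n → Bool
  aliceEdge x u v = crossing (decode u) (decode v) ∧ not (aliceH x (decode u) (decode v))

  aliceStream : Vec Bool (k * k) → List (Edge n)
  aliceStream x = edgesOf (aliceEdge x)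

  crossing-sym : ∀ a b → crossing a b ≡ crossing b a
  crossing-sym (left _ _)  (left _ _)  = refl
  crossing-sym (left _ _)  (right _ _) = refl
  crossing-sym (left _ _)  (padᶠ _)    = refl
  crossing-sym (left _ _)  (padᵗ _)    = refl
  crossing-sym (right _ _) (left _ _)  = refl
  crossing-sym (right _ _) (right _ _) = refl
  crossing-sym (right _ _) (padᶠ _)    = refl
  crossing-sym (right _ _) (padᵗ _)    = refl
  crossing-sym (padᶠ _)    (left _ _)  = refl
  crossing-sym (padᶠ _)    (right _ _) = refl
  crossing-sym (padᶠ _)    (padᶠ _)    = refl
  crossing-sym (padᶠ _)    (padᵗ _)    = refl
  crossing-sym (padᵗ _)    (left _ _)  = refl
  crossing-sym (padᵗ _)    (right _ _) = refl
  crossing-sym (padᵗ _)    (padᶠ _)    = refl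
  crossing-sym (padᵗ _)    (padᵗ _)    = refl

  aliceH-sym : ∀ x a b → aliceH x a b ≡ aliceH x b a
  aliceH-sym x (left _ _)  (left _ _)  = refl
  aliceH-sym x (left _ _)  (right _ _) = refl
  aliceH-sym x (left _ _)  (padᶠ _)    = refl
  aliceH-sym x (left _ _)  (padᵗ _)    = refl
  aliceH-sym x (right _ _) (left _ _)  = refl
  aliceH-sym x (right _ _) (right _ _) = refl
  aliceH-sym x (right _ _) (padᶠ _)    = refl
  aliceH-sym x (right _ _) (padᵗ _)    = refl
  aliceH-sym x (padᶠ _)    (left _ _)  = refl
  aliceH-sym x (padᶠ _)    (right _ _) = refl
  aliceH-sym x (padᶠ _)    (padᶠ _)    = refl
  aliceH-sym x (padᶠ _)    (padᵗ _)    = refl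
  aliceH-sym x (padᵗ _)    (left _ _)  = refl
  aliceH-sym x (padᵗ _)    (right _ _) = refl
  aliceH-sym x (padᵗ _)    (padᶠ _)    = refl
  aliceH-sym x (padᵗ _)    (padᵗ _)    = refl

  crossing-irrefl : ∀ a → crossing a a ≡ false
  crossing-irrefl (left _ _)  = refl
  crossing-irrefl (right _ _) = refl
  crossing-irrefl (padᶠ _)    = refl
  crossing-irrefl (padᵗ _)    = refl

  aliceEdge-sym : ∀ x → Symmetric₂ (aliceEdge x)
  aliceEdge-sym x u v = cong₂ (λ b c → b ∧ not c) (crossing-sym (decode u) (decode v)) (aliceH-sym x (decode u) (decode v))

  degree : V → ℕ
  degree (left _ _)  = k
  degree (right _ _) = k
  degree _           = 0

  ∑-zero : ∀ m → ∑ {m} (λ _ → 0) ≡ 0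
  ∑-zero m = trans (∑-const m 0) (*-zeroʳ m)

  -- The two copies of an index carry opposite adjacencies, so each index contributes exactly one
  -- neighbour.
  twins : ∀ (b : Fin k → Bool) c d → d ≡ not c → ∑ (λ i → ι (b i xor c)) + ∑ (λ i → ι (b i xor d)) ≡ k
  twins b c _ refl = trans (sym (∑-distrib-+ {k} (λ i → ι (b i xor c)) (λ i → ι (b i xor not c))))
    (trans (sum-cong-≗ (λ i → one-of (b i) c)) (trans (∑-const k 1) (*-identityʳ k)))
    where
    one-of : ∀ b c → ι (b xor c) + ι (b xor not c) ≡ 1
    one-of true  true  = refl
    one-of true  false = refl
    one-of false true  = refl
    one-of false false = refl

  aliceH-degree : ∀ x u → ∑ (λ v → ι (aliceH x (decode u) (decode v))) ≡ degree (decode u)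
  aliceH-degree x u = trans (∑-decode (ι ∘ aliceH x (decode u))) (row (decode u))
    where
    no-pads : ∑ {D} (λ _ → 0) + ∑ {E} (λ _ → 0) ≡ 0
    no-pads = cong₂ _+_ (∑-zero D) (∑-zero E)
    row : ∀ a → ∑ᵥ (ι ∘ aliceH x a) ≡ degree a
    row (left s i) = trans
      (cong₂ _+_ (∑-zero k) (cong₂ _+_ (∑-zero k)
        (cong (∑ (λ j → ι (bit j xor (s xor false))) +_)
          (trans (cong (∑ (λ j → ι (bit j xor (s xor true))) +_) no-pads) (+-identityʳ _)))))
      (twins bit (s xor false) (s xor true) (flip s))
      where
      bit : Fin k → Bool
      bit j = lookup x (combine i j)
      flip : ∀ s → s xor true ≡ not (s xor false)
      flip true  = refl
      flip false = refl
    row (right t j) = trans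
      (cong (∑ (λ i → ι (bit i xor t)) +_)
        (trans (cong (∑ (λ i → ι (bit i xor not t)) +_)
          (cong₂ _+_ (∑-zero k) (cong₂ _+_ (∑-zero k) no-pads))) (+-identityʳ _)))
      (twins bit t (not t) refl)
      where
      bit : Fin k → Bool
      bit i = lookup x (combine i j)
    row (padᶠ q) = cong₂ _+_ (∑-zero k) (cong₂ _+_ (∑-zero k) (cong₂ _+_ (∑-zero k) (cong₂ _+_ (∑-zero k) no-pads)))
    row (padᵗ p) = cong₂ _+_ (∑-zero k) (cong₂ _+_ (∑-zero k) (cong₂ _+_ (∑-zero k) (cong₂ _+_ (∑-zero k) no-pads)))

  aliceH-count : ∀ x → ∑₂ (λ u v → ι (aliceH x (decode u) (decode v))) ≡ ∑ (degree ∘ decode)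
  aliceH-count x = sum-cong-≗ (aliceH-degree x)

  -- The algorithm sees the number of edges read so far at no cost. Bob can continue the run only if
  -- that number does not depend on Alice's input.
  aliceStream-length : ∀ x y → length (aliceStream x) ≡ length (aliceStream y)
  aliceStream-length x y = *-cancelˡ-≡ _ _ 2 (+-cancelʳ-≡ (∑ (degree ∘ decode)) _ _ (trans (total x) (sym (total y))))
    where
    open ≡-Reasoning
    length-sum : ∀ (es : List (Edge n)) → length es ≡ sum (map (onEdge (λ _ _ → 1)) es)
    length-sum []       = refl
    length-sum (_ ∷ es) = cong suc (length-sum es)
    implied : ∀ x a b → ι (crossing a b ∧ not (aliceH x a b)) * 1 + ι (aliceH x a b) ≡ ι (crossing a b)
    implied x (left s i) (right t j) with aliceH x (left s i) (right t j)
    ... | true  = refl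
    ... | false = refl
    implied x (right t j) (left s i) with aliceH x (right t j) (left s i)
    ... | true  = refl
    ... | false = refl
    implied x (left _ _)  (left _ _)  = refl
    implied x (left _ _)  (padᶠ _)    = refl
    implied x (left _ _)  (padᵗ _)    = refl
    implied x (right _ _) (right _ _) = refl
    implied x (right _ _) (padᶠ _)    = refl
    implied x (right _ _) (padᵗ _)    = refl
    implied x (padᶠ _)    _           = refl
    implied x (padᵗ _)    _           = refl
    total : ∀ x → 2 * length (aliceStream x) + ∑ (degree ∘ decode) ≡ ∑₂ (λ u v → ι (crossing (decode u) (decode v)))
    total x = begin
      2 * length (aliceStream x) + ∑ (degree ∘ decode)
        ≡⟨ cong₂ (λ l s → 2 * l + s) (length-sum (aliceStream x)) (sym (aliceH-count x)) ⟩
      2 * sum (map (onEdge (λ _ _ → 1)) (aliceStream x)) + ∑₂ (λ u v → ι (aliceH x (decode u) (decode v)))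
        ≡⟨ cong (_+ ∑₂ (λ u v → ι (aliceH x (decode u) (decode v))))
             (edgesOf-sum (aliceEdge x) (λ _ _ → 1) (aliceEdge-sym x)
               (λ u → cong (_∧ not (aliceH x (decode u) (decode u))) (crossing-irrefl (decode u))) (λ _ _ → refl)) ⟩
      ∑₂ (λ u v → ι (aliceEdge x u v) * 1) + ∑₂ (λ u v → ι (aliceH x (decode u) (decode v)))
        ≡⟨ ∑₂-+ {n} (λ u v → ι (aliceEdge x u v) * 1) (λ u v → ι (aliceH x (decode u) (decode v))) ⟨
      ∑₂ (λ u v → ι (aliceEdge x u v) * 1 + ι (aliceH x (decode u) (decode v)))
        ≡⟨ ∑₂-cong {n} (λ u v → implied x (decode u) (decode v)) ⟩
      ∑₂ (λ u v → ι (crossing (decode u) (decode v))) ∎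

  ¬crossing⇒¬aliceH : ∀ x a b → crossing a b ≡ false → aliceH x a b ≡ false
  ¬crossing⇒¬aliceH x (left _ _)  (left _ _)  _ = refl
  ¬crossing⇒¬aliceH x (left _ _)  (padᶠ _)    _ = refl
  ¬crossing⇒¬aliceH x (left _ _)  (padᵗ _)    _ = refl
  ¬crossing⇒¬aliceH x (right _ _) (right _ _) _ = refl
  ¬crossing⇒¬aliceH x (right _ _) (padᶠ _)    _ = refl
  ¬crossing⇒¬aliceH x (right _ _) (padᵗ _)    _ = refl
  ¬crossing⇒¬aliceH x (padᶠ _)    _           _ = refl
  ¬crossing⇒¬aliceH x (padᵗ _)    _           _ = refl

  isPad : V → Bool
  isPad (left _ _)  = false
  isPad (right _ _) = false
  isPad _           = true

  crossing⇒¬pad : ∀ a b → crossing a b ≡ true → isPad a ∨ isPad b ≡ false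
  crossing⇒¬pad (left _ _)  (right _ _) _ = refl
  crossing⇒¬pad (right _ _) (left _ _)  _ = refl

  -- Bob's completion of the graph for one query

  module Query (i₀ j₀ : Fin k) where

    u₀ v₀ : Fin n
    u₀ = encode (left false i₀)
    v₀ = encode (right false j₀)

    -- Left vertices are on the true side and right vertices on the false side, except that `u₀` and
    -- `v₀`, both in copy `false`, are exchanged.
    sideᵥ : V → Bool
    sideᵥ (left s i)  = s ∨ not (does (i ≟ i₀))
    sideᵥ (right t j) = not t ∧ does (j ≟ j₀)
    sideᵥ (padᶠ _)    = false
    sideᵥ (padᵗ _)    = true

    side : Fin n → Bool
    side u = sideᵥ (decode u)

    -- A pair containing a pad is in `H` exactly when the intended cut splits it, so the intended
    -- cut loses nothing at the pads.
    bobH : V → V → Bool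
    bobH a b = (isPad a ∨ isPad b) ∧ (sideᵥ a xor sideᵥ b)

    bobEdge : Fin n → Fin n → Bool
    bobEdge u v = not (does (u ≟ v)) ∧ (not (crossing (decode u) (decode v)) ∧ not (bobH (decode u) (decode v)))

    bobStream : List (Edge n)
    bobStream = edgesOf bobEdge

    bobH-sym : ∀ a b → bobH a b ≡ bobH b a
    bobH-sym a b = cong₂ _∧_ (∨-comm (isPad a) (isPad b)) (xor-comm (sideᵥ a) (sideᵥ b))

    bobH-irrefl : ∀ a → bobH a a ≡ false
    bobH-irrefl a = trans (cong ((isPad a ∨ isPad a) ∧_) (xor-same (sideᵥ a))) (∧-zeroʳ _)

    bobEdge-sym : Symmetric₂ bobEdge
    bobEdge-sym u v = cong₂ _∧_ (cong not (does-sym u v))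
      (cong₂ (λ b c → not b ∧ not c) (crossing-sym (decode u) (decode v)) (bobH-sym (decode u) (decode v)))
      where
      does-sym : ∀ (u v : Fin n) → does (u ≟ v) ≡ does (v ≟ u)
      does-sym u v with u ≟ v
      ... | yes u≡v = sym (dec-true (v ≟ u) (sym u≡v))
      ... | no  u≢v = sym (dec-false (v ≟ u) (u≢v ∘ sym))

    bobEdge-irrefl : ∀ u → bobEdge u u ≡ false
    bobEdge-irrefl u rewrite dec-true (u ≟ u) refl = refl

    module _ (x : Vec Bool (k * k)) where

      Hᵥ : V → V → Bool
      Hᵥ a b = aliceH x a b ∨ bobH a b

      H : Fin n → Fin n → Bool
      H u v = Hᵥ (decode u) (decode v)

      ι-H : ∀ a b → ι (Hᵥ a b) ≡ ι (aliceH x a b) + ι (bobH a b)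
      ι-H a b with crossing a b in cr
      ... | true  rewrite crossing⇒¬pad a b cr = trans (cong ι (∨-identityʳ (aliceH x a b))) (sym (+-identityʳ _))
      ... | false rewrite ¬crossing⇒¬aliceH x a b cr = refl

      H-count : ∑₂ (λ u v → ι (H u v)) ≡ ∑ (degree ∘ decode) + ∑₂ (λ u v → ι (bobH (decode u) (decode v)))
      H-count = trans (∑₂-cong {n} (λ u v → ι-H (decode u) (decode v)))
        (trans (∑₂-+ {n} (λ u v → ι (aliceH x (decode u) (decode v))) (λ u v → ι (bobH (decode u) (decode v))))
          (cong (_+ ∑₂ (λ u v → ι (bobH (decode u) (decode v)))) (aliceH-count x)))

      stream : List (Edge n)
      stream = aliceStream x ++ bobStream

      graph : Graph n
      graph = record
        { edges        = stream
        ; edges-unique = Uniqueₚ.++⁺ (edgesOf-unique (aliceEdge x)) (edgesOf-unique bobEdge) disjoint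
        }
        where
        disjoint : ∀ {e} → e ∈ aliceStream x × e ∈ bobStream → ⊥
        disjoint {e} (e∈A , e∈B) = clash (decode (Edge.src e)) (decode (Edge.tgt e)) (does (Edge.src e ≟ Edge.tgt e))
          (Equivalence.to T-≡ (proj₂ (∈-filter⁻ (T? ∘ onEdge (aliceEdge x)) {xs = allEdges n} e∈A)))
          (Equivalence.to T-≡ (proj₂ (∈-filter⁻ (T? ∘ onEdge bobEdge) {xs = allEdges n} e∈B)))
          where
          clash : ∀ a b c → crossing a b ∧ not (aliceH x a b) ≡ true → not c ∧ (not (crossing a b) ∧ not (bobH a b)) ≡ true → ⊥
          clash a b c p q with crossing a b
          clash a b true  p () | true
          clash a b false p () | true
          clash a b c     () q | false

      -- An ordered pair falls into exactly one of four classes; weighting this by `w` and summing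
      -- yields `complement`.
      partition-of-pairs : ∀ u v → ι (aliceEdge x u v) + ι (bobEdge u v) + δ u v + ι (H u v) ≡ 1
      partition-of-pairs u v with u ≟ v
      ... | yes refl rewrite crossing-irrefl (decode u) | ¬crossing⇒¬aliceH x (decode u) (decode u) (crossing-irrefl (decode u))
                           | bobH-irrefl (decode u) = refl
      ... | no _ with crossing (decode u) (decode v) in cr
      ...   | true rewrite crossing⇒¬pad (decode u) (decode v) cr with aliceH x (decode u) (decode v)
      ...     | true  = refl
      ...     | false = refl
      partition-of-pairs u v | no _ | false rewrite ¬crossing⇒¬aliceH x (decode u) (decode v) cr with bobH (decode u) (decode v)
      ...     | true  = refl
      ...     | false = refl

      complement : ComplementOf H stream
      complement w w-sym = begin
        2 * sum (map (onEdge w) stream) + ∑ (λ u → w u u) + ∑₂ Hw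
          ≡⟨ cong (λ s → 2 * s + ∑ (λ u → w u u) + ∑₂ Hw) (trans (cong sum (map-++ (onEdge w) (aliceStream x) bobStream)) (sum-++ (map (onEdge w) (aliceStream x)) _)) ⟩
        2 * (sum (map (onEdge w) (aliceStream x)) + sum (map (onEdge w) bobStream)) + ∑ (λ u → w u u) + ∑₂ Hw
          ≡⟨ cong (λ s → s + ∑ (λ u → w u u) + ∑₂ Hw) (trans (*-distribˡ-+ 2 (sum (map (onEdge w) (aliceStream x))) _)
               (cong₂ _+_
                 (edgesOf-sum (aliceEdge x) w (aliceEdge-sym x) (λ u → cong (_∧ not (aliceH x (decode u) (decode u))) (crossing-irrefl (decode u))) w-sym)
                 (edgesOf-sum bobEdge w bobEdge-sym bobEdge-irrefl w-sym))) ⟩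
        ∑₂ Aw + ∑₂ Bw + ∑ (λ u → w u u) + ∑₂ Hw
          ≡⟨ cong (λ s → ∑₂ Aw + ∑₂ Bw + s + ∑₂ Hw) (sym diagonal) ⟩
        ∑₂ Aw + ∑₂ Bw + ∑₂ Dw + ∑₂ Hw
          ≡⟨ trans (∑₂-+ {n} _ Hw) (cong (_+ ∑₂ Hw) (trans (∑₂-+ {n} _ Dw) (cong (_+ ∑₂ Dw) (∑₂-+ {n} Aw Bw)))) ⟨
        ∑₂ (λ u v → Aw u v + Bw u v + Dw u v + Hw u v)
          ≡⟨ ∑₂-cong {n} (λ u v → trans (factor (ι (aliceEdge x u v)) (ι (bobEdge u v)) (δ u v) (ι (H u v)) (w u v))
               (trans (cong (_* w u v) (partition-of-pairs u v)) (+-identityʳ (w u v)))) ⟩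
        ∑₂ w ∎
        where
        open ≡-Reasoning
        Aw Bw Dw Hw : Fin n → Fin n → ℕ
        Aw u v = ι (aliceEdge x u v) * w u v
        Bw u v = ι (bobEdge u v) * w u v
        Dw u v = δ u v * w u v
        Hw u v = ι (H u v) * w u v
        factor : ∀ a b c d w → a * w + b * w + c * w + d * w ≡ (a + b + c + d) * w
        factor = solve-∀
        diagonal : ∑₂ Dw ≡ ∑ (λ u → w u u)
        diagonal = trans (∑-comm {n} {n} Dw) (sum-cong-≗ {n} (λ v → ∑-δ v (λ u → w u v)))

      -- The loss of the intended cut

      oppositeCount : Bool → ℕ
      oppositeCount b = ∑ (λ z → ι (b xor side z))

      oppositeCounts : oppositeCount true + oppositeCount false ≡ n
      oppositeCounts = trans (sym (∑-distrib-+ {n} (λ z → ι (not (side z))) (ι ∘ side)))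
        (trans (sum-cong-≗ {n} (λ z → one-of (side z))) (trans (∑-const n 1) (*-identityʳ n)))
        where
        one-of : ∀ b → ι (not b) + ι b ≡ 1
        one-of true  = refl
        one-of false = refl

      private
        A : Fin n → Fin n → ℕ
        A u v = ι (aliceH x (decode u) (decode v))

        A-sym : ∀ u v → A u v ≡ A v u
        A-sym u v = cong ι (aliceH-sym x (decode u) (decode v))

        -- `OT` is the size of the false side and `OF` that of the true side: what a pair inside the
        -- true, respectively false, side loses.
        OT OF : ℕ
        OT = oppositeCount true
        OF = oppositeCount false

        left-facts : ∀ u {s i} → decode u ≡ left s i →
                     δ u v₀ ≡ 0 × ((δ u u₀ ≡ 1 × side u ≡ false) ⊎ (δ u u₀ ≡ 0 × side u ≡ true))
        left-facts u {s} {i} du with u ≟ u₀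
        ... | yes refl = does-ι-no (u ≟ v₀) not-v₀ , inj₁ (refl , trans (cong sideᵥ (decode-encode (left false i₀))) (cong not (dec-true (i₀ ≟ i₀) refl)))
          where
          not-v₀ : u ≢ v₀
          not-v₀ u≡v₀ = contradiction (trans (sym du) (trans (cong decode u≡v₀) (decode-encode (right false j₀)))) λ ()
        ... | no u≢u₀ = does-ι-no (u ≟ v₀) not-v₀ , inj₂ (refl , trans (cong sideᵥ du) (on-side s i du))
          where
          not-v₀ : u ≢ v₀
          not-v₀ u≡v₀ = contradiction (trans (sym du) (trans (cong decode u≡v₀) (decode-encode (right false j₀)))) λ ()
          on-side : ∀ s i → decode u ≡ left s i → s ∨ not (does (i ≟ i₀)) ≡ true
          on-side true  i _  = refl
          on-side false i du with i ≟ i₀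
          ... | yes refl = contradiction (trans (sym (encode-decode u)) (cong encode du)) u≢u₀
          ... | no  _    = refl

        right-facts : ∀ u {t j} → decode u ≡ right t j →
                      δ u u₀ ≡ 0 × ((δ u v₀ ≡ 1 × side u ≡ true) ⊎ (δ u v₀ ≡ 0 × side u ≡ false))
        right-facts u {t} {j} du with u ≟ v₀
        ... | yes refl = does-ι-no (u ≟ u₀) not-u₀ , inj₁ (refl , trans (cong sideᵥ (decode-encode (right false j₀))) (dec-true (j₀ ≟ j₀) refl))
          where
          not-u₀ : u ≢ u₀
          not-u₀ u≡u₀ = contradiction (trans (sym du) (trans (cong decode u≡u₀) (decode-encode (left false i₀)))) λ ()
        ... | no u≢v₀ = does-ι-no (u ≟ u₀) not-u₀ , inj₂ (refl , trans (cong sideᵥ du) (off-side t j du))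
          where
          not-u₀ : u ≢ u₀
          not-u₀ u≡u₀ = contradiction (trans (sym du) (trans (cong decode u≡u₀) (decode-encode (left false i₀)))) λ ()
          off-side : ∀ t j → decode u ≡ right t j → not t ∧ does (j ≟ j₀) ≡ false
          off-side true  j _  = refl
          off-side false j du with j ≟ j₀
          ... | yes refl = contradiction (trans (sym (encode-decode u)) (cong encode du)) u≢v₀
          ... | no  _    = refl

        -- The numbers are the deltas of the two ends at `u₀` and `v₀`. The right side charges a
        -- pair at each hub it contains. The pair of both hubs is charged twice although it crosses
        -- the cut, and the product term on the left corrects this.
        Balanced : ℕ → ℕ → ℕ → ℕ → Bool → Bool → Set
        Balanced α β α′ β′ s s′ =
          ι (s == s′) * oppositeCount s + (α * β′ + β * α′) * (OT + OF) ≡ (β + β′) * OT + (α + α′) * OF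

        balanced-lr : ∀ {α β α′ β′ s s′} →
          β ≡ 0 × ((α ≡ 1 × s ≡ false) ⊎ (α ≡ 0 × s ≡ true)) →
          α′ ≡ 0 × ((β′ ≡ 1 × s′ ≡ true) ⊎ (β′ ≡ 0 × s′ ≡ false)) → Balanced α β α′ β′ s s′
        balanced-lr (refl , inj₁ (refl , refl)) (refl , inj₁ (refl , refl)) = both OT OF
          where
          both : ∀ a b → (1 * 1 + 0 * 0) * (a + b) ≡ (0 + 1) * a + (1 + 0) * b
          both = solve-∀
        balanced-lr (refl , inj₁ (refl , refl)) (refl , inj₂ (refl , refl)) = +-identityʳ (1 * OF)
        balanced-lr (refl , inj₂ (refl , refl)) (refl , inj₁ (refl , refl)) = refl
        balanced-lr (refl , inj₂ (refl , refl)) (refl , inj₂ (refl , refl)) = refl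

        balanced-rl : ∀ {α β α′ β′ s s′} →
          α ≡ 0 × ((β ≡ 1 × s ≡ true) ⊎ (β ≡ 0 × s ≡ false)) →
          β′ ≡ 0 × ((α′ ≡ 1 × s′ ≡ false) ⊎ (α′ ≡ 0 × s′ ≡ true)) → Balanced α β α′ β′ s s′
        balanced-rl (refl , inj₁ (refl , refl)) (refl , inj₁ (refl , refl)) = both OT OF
          where
          both : ∀ a b → (0 * 0 + 1 * 1) * (a + b) ≡ (1 + 0) * a + (0 + 1) * b
          both = solve-∀
        balanced-rl (refl , inj₁ (refl , refl)) (refl , inj₂ (refl , refl)) = refl
        balanced-rl (refl , inj₂ (refl , refl)) (refl , inj₁ (refl , refl)) = +-identityʳ (1 * OF)
        balanced-rl (refl , inj₂ (refl , refl)) (refl , inj₂ (refl , refl)) = refl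

        balanced : ∀ u v → A u v * (ι (side u == side v) * oppositeCount (side u)) + A u v * ((δ u u₀ * δ v v₀ + δ u v₀ * δ v u₀) * (OT + OF))
                         ≡ A u v * ((δ u v₀ + δ v v₀) * OT + (δ u u₀ + δ v u₀) * OF)
        balanced u v = weighted (decode u) refl (decode v) refl
          where
          weighted : ∀ a → decode u ≡ a → ∀ b → decode v ≡ b →
            ι (aliceH x a b) * (ι (side u == side v) * oppositeCount (side u))
              + ι (aliceH x a b) * ((δ u u₀ * δ v v₀ + δ u v₀ * δ v u₀) * (OT + OF))
            ≡ ι (aliceH x a b) * ((δ u v₀ + δ v v₀) * OT + (δ u u₀ + δ v u₀) * OF)
          weighted (left s i)  du (right t j) dv = trans (sym (*-distribˡ-+ (ι (aliceH x (left s i) (right t j))) _ _))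
            (cong (ι (aliceH x (left s i) (right t j)) *_) (balanced-lr (left-facts u du) (right-facts v dv)))
          weighted (right t j) du (left s i)  dv = trans (sym (*-distribˡ-+ (ι (aliceH x (right t j) (left s i))) _ _))
            (cong (ι (aliceH x (right t j) (left s i)) *_) (balanced-rl (right-facts u du) (left-facts v dv)))
          weighted (left _ _)  _ (left _ _)  _ = refl
          weighted (left _ _)  _ (padᶠ _)    _ = refl
          weighted (left _ _)  _ (padᵗ _)    _ = refl
          weighted (right _ _) _ (right _ _) _ = refl
          weighted (right _ _) _ (padᶠ _)    _ = refl
          weighted (right _ _) _ (padᵗ _)    _ = refl
          weighted (padᶠ _)    _ _           _ = refl
          weighted (padᵗ _)    _ _           _ = refl

        query-bit : Bool
        query-bit = lookup x (combine i₀ j₀)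

        same-side-loss : ℕ
        same-side-loss = ∑₂ (λ u v → A u v * (ι (side u == side v) * oppositeCount (side u)))

        -- Bob's pairs of `H` all cross the intended cut, so only Alice's remain, and the sum over
        -- `z` is the size of the opposite side.
        cutLoss-same-side : cutLoss H side ≡ same-side-loss
        cutLoss-same-side = ∑₂-cong {n} (λ u v → begin
          ∑ (λ z → ι (H u v) * ι ((side u == side v) ∧ (side u xor side z)))
            ≡⟨ sum-cong-≗ {n} (λ z → only-alice (decode u) (decode v) (side u xor side z)) ⟩
          ∑ (λ z → A u v * ι (side u == side v) * ι (side u xor side z))
            ≡⟨ *-distribˡ-∑ (A u v * ι (side u == side v)) (λ z → ι (side u xor side z)) ⟩
          A u v * ι (side u == side v) * oppositeCount (side u)
            ≡⟨ *-assoc (A u v) _ _ ⟩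
          A u v * (ι (side u == side v) * oppositeCount (side u)) ∎)
          where
          open ≡-Reasoning
          same-side : ∀ h p b c e → ι (h ∨ (p ∧ (b xor c))) * ι ((b == c) ∧ e) ≡ ι h * ι (b == c) * ι e
          same-side true  _     true  true  e = refl
          same-side true  _     true  false e = refl
          same-side true  _     false true  e = refl
          same-side true  _     false false e = refl
          same-side false p     true  true  e rewrite ∧-zeroʳ p = refl
          same-side false p     true  false e = *-zeroʳ (ι (p ∧ true))
          same-side false p     false true  e = *-zeroʳ (ι (p ∧ true))
          same-side false p     false false e rewrite ∧-zeroʳ p = refl
          only-alice : ∀ a b e → ι (Hᵥ a b) * ι ((sideᵥ a == sideᵥ b) ∧ e) ≡ ι (aliceH x a b) * ι (sideᵥ a == sideᵥ b) * ι e
          only-alice a b e = same-side (aliceH x a b) (isPad a ∨ isPad b) (sideᵥ a) (sideᵥ b) e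

        degree-u₀ : ∑ (A u₀) ≡ k
        degree-u₀ = trans (aliceH-degree x u₀) (cong degree (decode-encode (left false i₀)))

        degree-v₀ : ∑ (A v₀) ≡ k
        degree-v₀ = trans (aliceH-degree x v₀) (cong degree (decode-encode (right false j₀)))

        A-u₀v₀ : A u₀ v₀ ≡ ι query-bit
        A-u₀v₀ rewrite decode-encode (left false i₀) | decode-encode (right false j₀) = cong ι (xor-identityʳ query-bit)

        star-sums : ∀ c → ∑₂ (λ u v → (δ u c + δ v c) * A u v) ≡ 2 * ∑ (A c)
        star-sums c = begin
          ∑₂ (λ u v → (δ u c + δ v c) * A u v)            ≡⟨ ∑₂-cong {n} (λ u v → *-distribʳ-+ (A u v) (δ u c) (δ v c)) ⟩
          ∑₂ (λ u v → δ u c * A u v + δ v c * A u v)      ≡⟨ ∑₂-+ {n} (λ u v → δ u c * A u v) (λ u v → δ v c * A u v) ⟩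
          ∑₂ (λ u v → δ u c * A u v) + ∑₂ (λ u v → δ v c * A u v) ≡⟨ cong₂ _+_ (∑₂-pickˡ c A) (∑₂-pickʳ c A) ⟩
          ∑ (A c) + ∑ (λ u → A u c)                       ≡⟨ cong (∑ (A c) +_) (trans (sum-cong-≗ {n} (λ u → A-sym u c)) (sym (+-identityʳ (∑ (A c))))) ⟩
          2 * ∑ (A c)                                     ∎
          where open ≡-Reasoning

        pair-sum : ∑₂ (λ u v → (δ u u₀ * δ v v₀ + δ u v₀ * δ v u₀) * A u v) ≡ 2 * ι query-bit
        pair-sum = begin
          ∑₂ (λ u v → (δ u u₀ * δ v v₀ + δ u v₀ * δ v u₀) * A u v)
            ≡⟨ ∑₂-cong {n} (λ u v → expand (δ u u₀) (δ v v₀) (δ u v₀) (δ v u₀) (A u v)) ⟩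
          ∑₂ (λ u v → δ u u₀ * (δ v v₀ * A u v) + δ u v₀ * (δ v u₀ * A u v))
            ≡⟨ ∑₂-+ {n} (λ u v → δ u u₀ * (δ v v₀ * A u v)) (λ u v → δ u v₀ * (δ v u₀ * A u v)) ⟩
          ∑₂ (λ u v → δ u u₀ * (δ v v₀ * A u v)) + ∑₂ (λ u v → δ u v₀ * (δ v u₀ * A u v))
            ≡⟨ cong₂ _+_ (∑₂-pickˡ u₀ (λ u v → δ v v₀ * A u v)) (∑₂-pickˡ v₀ (λ u v → δ v u₀ * A u v)) ⟩
          ∑ (λ v → δ v v₀ * A u₀ v) + ∑ (λ v → δ v u₀ * A v₀ v)
            ≡⟨ cong₂ _+_ (∑-δ v₀ (A u₀)) (∑-δ u₀ (A v₀)) ⟩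
          A u₀ v₀ + A v₀ u₀
            ≡⟨ cong₂ _+_ A-u₀v₀ (trans (A-sym v₀ u₀) (trans A-u₀v₀ (sym (+-identityʳ _)))) ⟩
          2 * ι query-bit ∎
          where
          open ≡-Reasoning
          expand : ∀ a b c d e → (a * b + c * d) * e ≡ a * (b * e) + c * (d * e)
          expand = solve-∀

      -- `balanced` is summed over Alice's pairs: each hub lies in `2 * k` ordered pairs, charged
      -- `OT` at `v₀` and `OF` at `u₀`. Since both hubs have the same degree, only the total
      -- `OT + OF`, which is `n`, matters.
      cutLoss-side : cutLoss H side + 2 * n * ι query-bit ≡ 2 * n * k
      cutLoss-side = begin
        cutLoss H side + 2 * n * ι query-bit
          ≡⟨ cong₂ _+_ cutLoss-same-side (trans (regroup n (ι query-bit)) (cong₂ _*_ (sym oppositeCounts) (sym pair-sum))) ⟩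
        same-side-loss + (OT + OF) * ∑₂ P
          ≡⟨ cong (same-side-loss +_) (scale (OT + OF) P) ⟨
        same-side-loss + ∑₂ (λ u v → (OT + OF) * P u v)
          ≡⟨ ∑₂-+ {n} (λ u v → A u v * (ι (side u == side v) * oppositeCount (side u))) (λ u v → (OT + OF) * P u v) ⟨
        ∑₂ (λ u v → A u v * (ι (side u == side v) * oppositeCount (side u)) + (OT + OF) * P u v)
          ≡⟨ ∑₂-cong {n} (λ u v → trans
               (cong (A u v * (ι (side u == side v) * oppositeCount (side u)) +_) (rotate (OT + OF) (δ u u₀ * δ v v₀ + δ u v₀ * δ v u₀) (A u v)))
               (trans (balanced u v) (distribute (A u v) (δ u v₀ + δ v v₀) OT (δ u u₀ + δ v u₀) OF))) ⟩
        ∑₂ (λ u v → OT * ((δ u v₀ + δ v v₀) * A u v) + OF * ((δ u u₀ + δ v u₀) * A u v))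
          ≡⟨ trans (∑₂-+ {n} (λ u v → OT * ((δ u v₀ + δ v v₀) * A u v)) (λ u v → OF * ((δ u u₀ + δ v u₀) * A u v)))
               (cong₂ _+_ (scale OT (λ u v → (δ u v₀ + δ v v₀) * A u v)) (scale OF (λ u v → (δ u u₀ + δ v u₀) * A u v))) ⟩
        OT * ∑₂ (λ u v → (δ u v₀ + δ v v₀) * A u v) + OF * ∑₂ (λ u v → (δ u u₀ + δ v u₀) * A u v)
          ≡⟨ cong₂ (λ a b → OT * a + OF * b) (trans (star-sums v₀) (cong (2 *_) degree-v₀)) (trans (star-sums u₀) (cong (2 *_) degree-u₀)) ⟩
        OT * (2 * k) + OF * (2 * k)
          ≡⟨ collect OT OF k ⟩
        2 * (OT + OF) * k
          ≡⟨ cong (λ m → 2 * m * k) oppositeCounts ⟩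
        2 * n * k ∎
        where
        open ≡-Reasoning
        P : Fin n → Fin n → ℕ
        P u v = (δ u u₀ * δ v v₀ + δ u v₀ * δ v u₀) * A u v
        scale : ∀ c (F : Fin n → Fin n → ℕ) → ∑₂ (λ u v → c * F u v) ≡ c * ∑₂ F
        scale c F = trans (sum-cong-≗ {n} (λ u → *-distribˡ-∑ c (F u))) (*-distribˡ-∑ c (λ u → ∑ (F u)))
        regroup : ∀ n b → 2 * n * b ≡ n * (2 * b)
        regroup = solve-∀
        rotate : ∀ n p a → n * (p * a) ≡ a * (p * n)
        rotate = solve-∀
        distribute : ∀ a p t q f → a * (p * t + q * f) ≡ t * (p * a) + f * (q * a)
        distribute = solve-∀
        collect : ∀ t f k → t * (2 * k) + f * (2 * k) ≡ 2 * (t + f) * k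
        collect = solve-∀

      -- The loss of all other cuts

      private
        loss : (Fin n → Bool) → Fin n → Fin n → Fin n → ℕ
        loss U u v z = ι (H u v) * ι (separated U u v z)

        H-padᶠ : ∀ u q → H u (encode (padᶠ q)) ≡ side u
        H-padᶠ u q rewrite decode-encode (padᶠ q) = to-padᶠ (decode u)
          where
          to-padᶠ : ∀ a → Hᵥ a (padᶠ q) ≡ sideᵥ a
          to-padᶠ (left s i)  = xor-identityʳ _
          to-padᶠ (right t j) = xor-identityʳ _
          to-padᶠ (padᶠ _)    = refl
          to-padᶠ (padᵗ _)    = refl

        H-padᵗ : ∀ u p → H u (encode (padᵗ p)) ≡ not (side u)
        H-padᵗ u p rewrite decode-encode (padᵗ p) = to-padᵗ (decode u)
          where
          to-padᵗ : ∀ a → Hᵥ a (padᵗ p) ≡ not (sideᵥ a)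
          to-padᵗ (left s i)  = xor-comm _ true
          to-padᵗ (right t j) = xor-comm _ true
          to-padᵗ (padᶠ _)    = refl
          to-padᵗ (padᵗ _)    = refl

        side-padᶠ : ∀ q → side (encode (padᶠ q)) ≡ false
        side-padᶠ q = cong sideᵥ (decode-encode (padᶠ q))

        side-padᵗ : ∀ p → side (encode (padᵗ p)) ≡ true
        side-padᵗ p = cong sideᵥ (decode-encode (padᵗ p))

        ∑-row≤ : ∀ U u → ∑₂ (loss U u) ≤ cutLoss H U
        ∑-row≤ U u = ∑-term (λ u → ∑₂ (loss U u)) u

        loss-1 : ∀ U u v z → H u v ≡ true → U u ≡ U v → U u ≢ U z → loss U u v z ≡ 1
        loss-1 U u v z Huv Uu≡Uv Uu≢Uz rewrite Huv | Uu≡Uv | ==-refl (U v) = cong (λ b → ι b + 0) (xor-≢ Uu≢Uz)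
          where
          xor-≢ : ∀ {b c} → b ≢ c → b xor c ≡ true
          xor-≢ {true}  {true}  b≢c = contradiction refl b≢c
          xor-≢ {true}  {false} _   = refl
          xor-≢ {false} {true}  _   = refl
          xor-≢ {false} {false} b≢c = contradiction refl b≢c

        ∑₂-const : ∀ a b → ∑ {a} (λ _ → ∑ {b} (λ _ → 1)) ≡ a * b
        ∑₂-const a b = trans (sum-cong-≗ {a} (λ _ → trans (∑-const b 1) (*-identityʳ b))) (∑-const a b)

        -- `H` is complete between the two pad classes, so the abstract count `split-loss` bounds
        -- the lost triples with `u` and `z` in one class and `v` in the other.
        padᵗ-split : ∀ U {p p′} → U (encode (padᵗ p)) ≢ U (encode (padᵗ p′)) → E * D ≤ 2 * cutLoss H U
        padᵗ-split U U≢ = ≤-trans (split-loss (U ∘ encode ∘ padᵗ) (U ∘ encode ∘ padᶠ) U≢) (*-monoʳ-≤ 2 (begin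
          ∑ {E} (λ p → ∑ {D} (λ q → ∑ {E} (λ z → ι (separated U (encode (padᵗ p)) (encode (padᶠ q)) (encode (padᵗ z))))))
            ≤⟨ ∑-mono {E} (λ p → ∑-mono {D} (λ q → ≤-trans (∑-mono {E} (λ z → present p q z)) (∑-padᵗ≤ (loss U (encode (padᵗ p)) (encode (padᶠ q)))))) ⟩
          ∑ {E} (λ p → ∑ {D} (λ q → ∑ (loss U (encode (padᵗ p)) (encode (padᶠ q)))))
            ≤⟨ ∑-mono {E} (λ p → ∑-padᶠ≤ (λ v → ∑ (loss U (encode (padᵗ p)) v))) ⟩
          ∑ {E} (λ p → ∑₂ (loss U (encode (padᵗ p))))
            ≤⟨ ∑-padᵗ≤ (λ u → ∑₂ (loss U u)) ⟩
          cutLoss H U ∎))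
          where
          open ≤-Reasoning
          present : ∀ p q z → ι (separated U (encode (padᵗ p)) (encode (padᶠ q)) (encode (padᵗ z))) ≤ loss U (encode (padᵗ p)) (encode (padᶠ q)) (encode (padᵗ z))
          present p q z rewrite H-padᶠ (encode (padᵗ p)) q | side-padᵗ p = ≤-reflexive (sym (+-identityʳ _))

        padᶠ-split : ∀ U {q q′} → U (encode (padᶠ q)) ≢ U (encode (padᶠ q′)) → D * E ≤ 2 * cutLoss H U
        padᶠ-split U U≢ = ≤-trans (split-loss (U ∘ encode ∘ padᶠ) (U ∘ encode ∘ padᵗ) U≢) (*-monoʳ-≤ 2 (begin
          ∑ {D} (λ q → ∑ {E} (λ p → ∑ {D} (λ z → ι (separated U (encode (padᶠ q)) (encode (padᵗ p)) (encode (padᶠ z))))))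
            ≤⟨ ∑-mono {D} (λ q → ∑-mono {E} (λ p → ≤-trans (∑-mono {D} (λ z → present q p z)) (∑-padᶠ≤ (loss U (encode (padᶠ q)) (encode (padᵗ p)))))) ⟩
          ∑ {D} (λ q → ∑ {E} (λ p → ∑ (loss U (encode (padᶠ q)) (encode (padᵗ p)))))
            ≤⟨ ∑-mono {D} (λ q → ∑-padᵗ≤ (λ v → ∑ (loss U (encode (padᶠ q)) v))) ⟩
          ∑ {D} (λ q → ∑₂ (loss U (encode (padᶠ q))))
            ≤⟨ ∑-padᶠ≤ (λ u → ∑₂ (loss U u)) ⟩
          cutLoss H U ∎))
          where
          open ≤-Reasoning
          present : ∀ q p z → ι (separated U (encode (padᶠ q)) (encode (padᵗ p)) (encode (padᶠ z))) ≤ loss U (encode (padᶠ q)) (encode (padᵗ p)) (encode (padᶠ z))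
          present q p z rewrite H-padᵗ (encode (padᶠ q)) p | side-padᶠ q = ≤-reflexive (sym (+-identityʳ _))

        -- Here α and γ are the constant values of U on the two kinds of pads.
        module ConstantOnPads (U : Fin n → Bool) {α γ : Bool}
                 (Uᵗ : ∀ p → U (encode (padᵗ p)) ≡ α) (Uᶠ : ∀ q → U (encode (padᶠ q)) ≡ γ) where

          -- All pairs between the two pad classes lie on one side, and the single vertex `z` is
          -- lost to each of them.
          pads-together : α ≡ γ → ∀ {z} → U z ≢ α → E * D ≤ cutLoss H U
          pads-together α≡γ {z} Uz≢α = begin
            E * D                                                            ≡⟨ ∑₂-const E D ⟨
            ∑ {E} (λ p → ∑ {D} (λ q → 1))                                    ≡⟨ sum-cong-≗ {E} (λ p → sum-cong-≗ {D} (λ q → lost p q)) ⟨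
            ∑ {E} (λ p → ∑ {D} (λ q → loss U (encode (padᵗ p)) (encode (padᶠ q)) z)) ≤⟨ ∑-mono {E} (λ p → ∑-mono {D} (λ q → ∑-term (loss U (encode (padᵗ p)) (encode (padᶠ q))) z)) ⟩
            ∑ {E} (λ p → ∑ {D} (λ q → ∑ (loss U (encode (padᵗ p)) (encode (padᶠ q))))) ≤⟨ ∑-mono {E} (λ p → ∑-padᶠ≤ (λ v → ∑ (loss U (encode (padᵗ p)) v))) ⟩
            ∑ {E} (λ p → ∑₂ (loss U (encode (padᵗ p))))                      ≤⟨ ∑-padᵗ≤ (λ u → ∑₂ (loss U u)) ⟩
            cutLoss H U                                                      ∎
            where
            open ≤-Reasoning
            lost : ∀ p q → loss U (encode (padᵗ p)) (encode (padᶠ q)) z ≡ 1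
            lost p q = loss-1 U _ _ z (trans (H-padᶠ (encode (padᵗ p)) q) (side-padᵗ p))
              (trans (Uᵗ p) (trans α≡γ (sym (Uᶠ q)))) (λ Up≡Uz → Uz≢α (trans (sym Up≡Uz) (Uᵗ p)))

          -- Such a `u` is joined in `H` to every `padᶠ`, now on its own side, and each of these
          -- pairs loses every `padᵗ`.
          misplaced-true : ∀ {u} → side u ≡ true → U u ≡ γ → U u ≢ α → D * E ≤ cutLoss H U
          misplaced-true {u} u-true Uu≡γ Uu≢α = begin
            D * E                                                            ≡⟨ ∑₂-const D E ⟨
            ∑ {D} (λ q → ∑ {E} (λ p → 1))                                    ≡⟨ sum-cong-≗ {D} (λ q → sum-cong-≗ {E} (λ p → lost q p)) ⟨
            ∑ {D} (λ q → ∑ {E} (λ p → loss U u (encode (padᶠ q)) (encode (padᵗ p)))) ≤⟨ ∑-mono {D} (λ q → ∑-padᵗ≤ (loss U u (encode (padᶠ q)))) ⟩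
            ∑ {D} (λ q → ∑ (loss U u (encode (padᶠ q))))                     ≤⟨ ∑-padᶠ≤ (λ v → ∑ (loss U u v)) ⟩
            ∑₂ (loss U u)                                                    ≤⟨ ∑-row≤ U u ⟩
            cutLoss H U                                                      ∎
            where
            open ≤-Reasoning
            lost : ∀ q p → loss U u (encode (padᶠ q)) (encode (padᵗ p)) ≡ 1
            lost q p = loss-1 U u _ _ (trans (H-padᶠ u q) u-true) (trans Uu≡γ (sym (Uᶠ q))) (λ Uu≡Up → Uu≢α (trans Uu≡Up (Uᵗ p)))

          misplaced-false : ∀ {u} → side u ≡ false → U u ≡ α → U u ≢ γ → E * D ≤ cutLoss H U
          misplaced-false {u} u-false Uu≡α Uu≢γ = begin
            E * D                                                            ≡⟨ ∑₂-const E D ⟨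
            ∑ {E} (λ p → ∑ {D} (λ q → 1))                                    ≡⟨ sum-cong-≗ {E} (λ p → sum-cong-≗ {D} (λ q → lost p q)) ⟨
            ∑ {E} (λ p → ∑ {D} (λ q → loss U u (encode (padᵗ p)) (encode (padᶠ q)))) ≤⟨ ∑-mono {E} (λ p → ∑-padᶠ≤ (loss U u (encode (padᵗ p)))) ⟩
            ∑ {E} (λ p → ∑ (loss U u (encode (padᵗ p))))                     ≤⟨ ∑-padᵗ≤ (λ v → ∑ (loss U u v)) ⟩
            ∑₂ (loss U u)                                                    ≤⟨ ∑-row≤ U u ⟩
            cutLoss H U                                                      ∎
            where
            open ≤-Reasoning
            lost : ∀ p q → loss U u (encode (padᵗ p)) (encode (padᶠ q)) ≡ 1
            lost p q = loss-1 U u _ _ (trans (H-padᵗ u p) (cong not u-false)) (trans Uu≡α (sym (Uᵗ p))) (λ Uu≡Uq → Uu≢γ (trans Uu≡Uq (Uᶠ q)))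

        -- With `α` true the cut is `side`, with `α` false its negation; the loss does not see the
        -- names of the two sides.
        cutLoss-≗ : ∀ U α → (∀ u → U u ≡ side u == α) → cutLoss H U ≡ cutLoss H side
        cutLoss-≗ U α U≗ = ∑₃-cong {n} (λ u v z → cong (ι (H u v) *_)
          (cong ι (trans (cong₂ (λ b c → (b == proj₁ c) ∧ (b xor proj₂ c)) (U≗ u) (cong₂ _,_ (U≗ v) (U≗ z)))
            (up-to-swap α (side u) (side v) (side z)))))
          where
          up-to-swap : ∀ α b c d → ((b == α) == (c == α)) ∧ ((b == α) xor (d == α)) ≡ (b == c) ∧ (b xor d)
          up-to-swap true  true  true  true  = refl
          up-to-swap true  true  true  false = refl
          up-to-swap true  true  false _     = refl
          up-to-swap true  false true  _     = refl
          up-to-swap true  false false true  = refl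
          up-to-swap true  false false false = refl
          up-to-swap false true  true  true  = refl
          up-to-swap false true  true  false = refl
          up-to-swap false true  false _     = refl
          up-to-swap false false true  _     = refl
          up-to-swap false false false true  = refl
          up-to-swap false false false false = refl

        ≢-≢⇒≡ : ∀ {a b c : Bool} → a ≢ b → c ≢ b → a ≡ c
        ≢-≢⇒≡ {true}  {true}          a≢b _   = contradiction refl a≢b
        ≢-≢⇒≡ {true}  {false} {true}  _   _   = refl
        ≢-≢⇒≡ {true}  {false} {false} _   c≢b = contradiction refl c≢b
        ≢-≢⇒≡ {false} {false}         a≢b _   = contradiction refl a≢b
        ≢-≢⇒≡ {false} {true}  {false} _   _   = refl
        ≢-≢⇒≡ {false} {true}  {true}  _   c≢b = contradiction refl c≢b


      -- Either a pad class is split, or both classes are on one side, or some vertex is on the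
      -- wrong side relative to the pads, or `U` is the intended cut up to swapping sides.
      other-cuts : ∀ U → (∃₂ λ u v → U u ≢ U v) → Fin E → Fin D →
                   E * D ≤ 2 * cutLoss H U ⊎ cutLoss H U ≡ cutLoss H side
      other-cuts U (u , v , Uu≢Uv) p₀ q₀
        with all? (λ p → U (encode (padᵗ p)) ≟ᵇ U (encode (padᵗ p₀))) | all? (λ q → U (encode (padᶠ q)) ≟ᵇ U (encode (padᶠ q₀)))
      ... | no ¬const | _ with ¬∀⟶∃¬ E _ (λ p → U (encode (padᵗ p)) ≟ᵇ U (encode (padᵗ p₀))) ¬const
      ...   | p , Up≢ = inj₁ (padᵗ-split U Up≢)
      other-cuts U (u , v , Uu≢Uv) p₀ q₀ | yes _ | no ¬const with ¬∀⟶∃¬ D _ (λ q → U (encode (padᶠ q)) ≟ᵇ U (encode (padᶠ q₀))) ¬const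
      ...   | q , Uq≢ = inj₁ (≤-trans (≤-reflexive (*-comm E D)) (padᶠ-split U Uq≢))
      other-cuts U (u , v , Uu≢Uv) p₀ q₀ | yes Uᵗ | yes Uᶠ = compare
        where
        open ConstantOnPads U {U (encode (padᵗ p₀))} {U (encode (padᶠ q₀))} Uᵗ Uᶠ
        α γ : Bool
        α = U (encode (padᵗ p₀))
        γ = U (encode (padᶠ q₀))
        enough : E * D ≤ cutLoss H U → E * D ≤ 2 * cutLoss H U ⊎ cutLoss H U ≡ cutLoss H side
        enough ED≤ = inj₁ (≤-trans ED≤ (m≤m+n _ _))
        compare : E * D ≤ 2 * cutLoss H U ⊎ cutLoss H U ≡ cutLoss H side
        compare with α ≟ᵇ γ | all? (λ u → U u ≟ᵇ (side u == α))
        ... | no _    | yes U≗ = inj₂ (cutLoss-≗ U α U≗)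
        ... | yes α≡γ | _ with U u ≟ᵇ α
        ...   | no  Uu≢α = enough (pads-together α≡γ Uu≢α)
        ...   | yes Uu≡α = enough (pads-together α≡γ (λ Uv≡α → Uu≢Uv (trans Uu≡α (sym Uv≡α))))
        compare | no α≢γ | no ¬≗ with ¬∀⟶∃¬ n _ (λ u → U u ≟ᵇ (side u == α)) ¬≗
        ...   | w , Uw≢ with side w in sw
        ...     | true  = enough (≤-trans (≤-reflexive (*-comm E D)) (misplaced-true sw (≢-≢⇒≡ Uw≢ (α≢γ ∘ sym)) Uw≢))
        ...     | false = enough (misplaced-false sw Uw≡α (λ Uw≡γ → α≢γ (trans (sym Uw≡α) Uw≡γ)))
          where
          not-≢ : ∀ {b c} → b ≢ not c → b ≡ c
          not-≢ {true}  {true}  _ = refl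
          not-≢ {true}  {false} b≢ = contradiction refl b≢
          not-≢ {false} {true}  b≢ = contradiction refl b≢
          not-≢ {false} {false} _ = refl
          Uw≡α : U w ≡ α
          Uw≡α = not-≢ Uw≢

      u₀≢v₀ : u₀ ≢ v₀
      u₀≢v₀ u₀≡v₀ = contradiction
        (trans (sym (decode-encode (left false i₀))) (trans (cong decode u₀≡v₀) (decode-encode (right false j₀)))) λ ()

      side-u₀ : side u₀ ≡ false
      side-u₀ = trans (cong sideᵥ (decode-encode (left false i₀))) (cong not (dec-true (i₀ ≟ i₀) refl))

      side-v₀ : side v₀ ≡ true
      side-v₀ = trans (cong sideᵥ (decode-encode (right false j₀))) (dec-true (j₀ ≟ j₀) refl)

      H-distinct : ∀ {u v} → H u v ≡ true → u ≢ v
      H-distinct {u} Huu refl = contradiction (trans (sym Huu) (cong₂ _∨_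
        (¬crossing⇒¬aliceH x (decode u) (decode u) (crossing-irrefl (decode u))) (bobH-irrefl (decode u)))) λ ()

      -- This is the star shape that the caterpillars need. Without a hub, Alice's pairs join left
      -- to right and thus cross, as do all pairs with a pad.
      H-same-side : ∀ {u v} → H u v ≡ true → side u ≡ side v → (u ≡ v₀ ⊎ v ≡ v₀) ⊎ (u ≡ u₀ ⊎ v ≡ u₀)
      H-same-side {u} {v} Huv same = classify (decode u) refl (decode v) refl Huv same
        where
        at : ∀ {w a} → decode w ≡ a → w ≡ encode a
        at {w} dw = trans (sym (encode-decode w)) (cong encode dw)
        cross : ∀ s i t j → s ∨ not (does (i ≟ i₀)) ≡ not t ∧ does (j ≟ j₀) →
                _≡_ {A = V} (left s i) (left false i₀) ⊎ _≡_ {A = V} (right t j) (right false j₀)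
        cross true  i true  j ()
        cross true  i false j same with j ≟ j₀
        ... | yes refl = inj₂ refl
        cross false i t     j same with i ≟ i₀
        ... | yes refl = inj₁ refl
        cross false i false j same | no _ with j ≟ j₀
        ... | yes refl = inj₂ refl
        opposite : ∀ b c → b ≡ c → b xor c ≡ true → ⊥
        opposite b _ refl eq = contradiction (trans (sym eq) (xor-same b)) λ ()
        classify : ∀ a → decode u ≡ a → ∀ b → decode v ≡ b → Hᵥ a b ≡ true → sideᵥ a ≡ sideᵥ b →
                   (u ≡ v₀ ⊎ v ≡ v₀) ⊎ (u ≡ u₀ ⊎ v ≡ u₀)
        classify (left s i)  du (right t j) dv h same with cross s i t j same
        ... | inj₁ refl = inj₂ (inj₁ (at du))
        ... | inj₂ refl = inj₁ (inj₂ (at dv))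
        classify (right t j) du (left s i)  dv h same with cross s i t j (sym same)
        ... | inj₁ refl = inj₂ (inj₂ (at dv))
        ... | inj₂ refl = inj₁ (inj₁ (at du))
        classify (left s i)  _ (padᶠ q)    _ h same = ⊥-elim (opposite (sideᵥ (left s i)) (sideᵥ (padᶠ q)) same h)
        classify (left s i)  _ (padᵗ p)    _ h same = ⊥-elim (opposite (sideᵥ (left s i)) (sideᵥ (padᵗ p)) same h)
        classify (right t j) _ (padᶠ q)    _ h same = ⊥-elim (opposite (sideᵥ (right t j)) (sideᵥ (padᶠ q)) same h)
        classify (right t j) _ (padᵗ p)    _ h same = ⊥-elim (opposite (sideᵥ (right t j)) (sideᵥ (padᵗ p)) same h)
        classify (padᶠ q)    _ (left s i)  _ h same = ⊥-elim (opposite (sideᵥ (padᶠ q)) (sideᵥ (left s i)) same h)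
        classify (padᶠ q)    _ (right t j) _ h same = ⊥-elim (opposite (sideᵥ (padᶠ q)) (sideᵥ (right t j)) same h)
        classify (padᵗ p)    _ (left s i)  _ h same = ⊥-elim (opposite (sideᵥ (padᵗ p)) (sideᵥ (left s i)) same h)
        classify (padᵗ p)    _ (right t j) _ h same = ⊥-elim (opposite (sideᵥ (padᵗ p)) (sideᵥ (right t j)) same h)

    -- Reading the bit off the optimum

    bobH-count : ℕ
    bobH-count = ∑ (degree ∘ decode) + ∑₂ (λ u v → ι (bobH (decode u) (decode v)))

    -- Bob can evaluate this alone: `bobH-count` is the number of ordered pairs of all of `H`, and
    -- Alice's share of it is determined by the degrees.
    scaled : ℕ → ℕ
    scaled r = 3 * (2 * r + n + n * bobH-count)

    -- The root cut of an optimal tree gives the lower bound and the two caterpillars the upper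
    -- bound. They meet because the intended cut loses at most `2 * n * k`, and `large` makes this
    -- at most the loss of any competitor.
    OPT-value : Fin E → Fin D → 2 * (2 * n * k) ≤ E * D → ∀ x {r} → IsOPT (graph x) r →
                scaled r + 3 * (2 * n * ι (lookup x (combine i₀ j₀))) ≡ 2 * (n * (n * n)) + n + 3 * (2 * n * k)
    OPT-value p₀ q₀ large x {r} ((T , costT≡r) , r-min) =
      combine-bounds (2 * (n * (n * n)) + n) (scaled r) (cutLoss (H x) side)
        (2 * n * ι (lookup x (combine i₀ j₀))) (2 * n * k) upper lower (cutLoss-side x)
      where
      T₀ : HCTree n
      T₀ = two-caterpillars side (side-v₀ x) (side-u₀ x)
      side-optimal : ∀ U → (∃₂ λ u v → U u ≢ U v) → cutLoss (H x) side ≤ cutLoss (H x) U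
      side-optimal U nontrivial with other-cuts x U nontrivial p₀ q₀
      ... | inj₂ eq  = ≤-reflexive (sym eq)
      ... | inj₁ ED≤ = half-bound (cutLoss (H x) side) (2 * n * ι (lookup x (combine i₀ j₀))) (2 * n * k) (E * D) (cutLoss (H x) U) (cutLoss-side x) large ED≤
      resolved : ∀ {u v z} → H x u v ≡ true → Below (HCTree.tree T₀) u v z ⊎ separated side u v z ≡ true
      resolved {u} {v} {z} Huv = two-caterpillars-below side (side-v₀ x) (side-u₀ x) {u} {v} {z} (H-distinct x Huv) (H-same-side x Huv)
      upper : scaled r ≤ 2 * (n * (n * n)) + n + 3 * cutLoss (H x) side
      upper = weaken-cost r (cost (graph x) T₀) n (∑₂ (λ u v → ι (H x u v))) bobH-count
        (2 * (n * (n * n)) + n + 3 * cutLoss (H x) side) (r-min (cost (graph x) T₀) (T₀ , refl)) (H-count x)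
        (cost-upper-bound (graph x) (H x) (complement x) T₀ (two-caterpillars-binary side (side-v₀ x) (side-u₀ x)) side resolved)
      lower : 2 * (n * (n * n)) + n + 3 * cutLoss (H x) side ≤ scaled r
      lower = weaken-loss r (cost (graph x) T) n (∑₂ (λ u v → ι (H x u v))) bobH-count
        (2 * (n * (n * n)) + n) (cutLoss (H x) side) (cutLoss (H x) (proj₁ cut)) costT≡r (H-count x)
        (side-optimal (proj₁ cut) (proj₁ (proj₂ cut))) (proj₂ (proj₂ cut))
        where
        cut : ∃ λ (U : Fin n → Bool) → (∃₂ λ u v → U u ≢ U v) × 2 * (n * (n * n)) + n + 3 * cutLoss (H x) U
              ≤ 3 * (2 * cost (graph x) T + n + n * ∑₂ (λ u v → ι (H x u v)))
        cut = cost-lower-bound (graph x) (H x) (complement x) T (u₀≢v₀ x)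

    -- Tests the equation of `OPT-value` for the bit 1; by `gap` it fails when the bit is 0.
    decodeBit : ℕ → Bool
    decodeBit r = does (scaled r + 3 * (2 * n * 1) ≟ℕ 2 * (n * (n * n)) + n + 3 * (2 * n * k))

    decodeBit-correct : ∀ r b → scaled r + 3 * (2 * n * ι b) ≡ 2 * (n * (n * n)) + n + 3 * (2 * n * k) → decodeBit r ≡ b
    decodeBit-correct r true  eq = dec-true (_ ≟ℕ _) eq
    decodeBit-correct r false eq = dec-false (_ ≟ℕ _) (λ eq′ → n≢0 u₀ (gap n (scaled r) (trans eq′ (sym eq))))
      where
      n≢0 : ∀ {m} → Fin m → m ≢ 0
      n≢0 {zero} () _

-- From streaming algorithms to INDEX protocols

-- Keeps the input length a variable, so that `k * k` can be put in although it has the required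
-- form only propositionally.
index-bound : ∀ {N} t r m .⦃ _ : NonZero r ⦄ → N ≡ 3 * (5 * t) →
  (msg : Fin r → Vec Bool N → List Bool) (dec : Fin r → List Bool → Fin N → Bool) →
  (∀ ω x → length (msg ω x) ≤ m) →
  (∀ x e → Pr≥2/3 (λ ω → dec ω (msg ω x) e ≡ lookup x e)) → t ≤ suc m
index-bound t r m refl = index-lower-bound t r m

module _ {n : ℕ} (A : StreamingAlgorithm n) where
  open StreamingAlgorithm A

  runFrom-++ : ∀ ω t s σ τ → runFrom ω t s (σ ++ τ) ≡ runFrom ω (t + length σ) (runFrom ω t s σ) τ
  runFrom-++ ω t s []      τ = cong (λ t → runFrom ω t s τ) (sym (+-identityʳ t))
  runFrom-++ ω t s (e ∷ σ) τ = trans (runFrom-++ ω (suc t) (step ω t e s) σ τ)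
    (cong (λ t′ → runFrom ω t′ (runFrom ω (suc t) (step ω t e s) σ) τ) (sym (+-suc t (length σ))))

module _ (k D E t : ℕ) (k*k≡15t : k * k ≡ 3 * (5 * t)) (p₀ : Fin E) (q₀ : Fin D)
         (large : 2 * (2 * Gadget.n k D E * k) ≤ E * D) where
  open Gadget k D E

  gadget-memory-bound : (A : StreamingAlgorithm n) → ComputesOPT A → ∀ m → IsMemory A m → t ≤ suc m
  gadget-memory-bound A computes m (_ , m-max) =
    index-bound t seeds m k*k≡15t message decodeMessage message-short message-correct
    where
    open StreamingAlgorithm A

    -- Any input would do, as all of Alice's streams have the same length.
    time : ℕ
    time = length (aliceStream (replicate (k * k) false))

    message : Fin seeds → Vec Bool (k * k) → List Bool
    message ω x = memoryAfter ω (aliceStream x)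

    answer : Fin seeds → List Bool → Fin k → Fin k → ℕ
    answer ω s i j = output ω (time + length (Query.bobStream i j)) (runFrom ω time s (Query.bobStream i j))

    decodeMessage : Fin seeds → List Bool → Fin (k * k) → Bool
    decodeMessage ω s e = Query.decodeBit (proj₁ (remQuot k e)) (proj₂ (remQuot {k} k e)) (answer ω s (proj₁ (remQuot k e)) (proj₂ (remQuot {k} k e)))

    -- Alice's edges alone already form a graph, so the maximum defining the memory covers the state
    -- handed to Bob.
    message-short : ∀ ω x → length (message ω x) ≤ m
    message-short ω x = m-max _ (record { edges = aliceStream x ; edges-unique = edgesOf-unique (aliceEdge x) }
      , aliceStream x , ω , ↭-refl , refl)

    answer-result : ∀ ω x i j → answer ω (message ω x) i j ≡ result ω (aliceStream x ++ Query.bobStream i j)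
    answer-result ω x i j = cong₂ (output ω)
      (trans (cong (_+ length bob) same-time) (sym (length-++ (aliceStream x))))
      (trans (cong (λ t → runFrom ω t (message ω x) bob) same-time) (sym (runFrom-++ A ω 0 (init ω) (aliceStream x) bob)))
      where
      bob : List (Edge n)
      bob = Query.bobStream i j
      same-time : time ≡ length (aliceStream x)
      same-time = aliceStream-length _ x

    message-correct : ∀ x e → Pr≥2/3 (λ ω → decodeMessage ω (message ω x) e ≡ lookup x e)
    message-correct x e with computes (Query.graph i j x) (Query.stream i j x) ↭-refl
      where
      i j : Fin k
      i = proj₁ (remQuot k e)
      j = proj₂ (remQuot {k} k e)
    ... | S , S-correct , S-large = S , (λ ω ω∈S → decoded ω (S-correct ω ω∈S)) , S-large
      where
      i j : Fin k
      i = proj₁ (remQuot k e)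
      j = proj₂ (remQuot {k} k e)
      decoded : ∀ ω → IsOPT (Query.graph i j x) (result ω (Query.stream i j x)) → decodeMessage ω (message ω x) e ≡ lookup x e
      decoded ω opt = trans (cong (Query.decodeBit i j) (answer-result ω x i j))
        (trans (Query.decodeBit-correct i j (result ω (Query.stream i j x)) (lookup x (combine i j)) (Query.OPT-value i j p₀ q₀ large x opt))
          (cong (lookup x) (combine-remQuot {k} k e)))

bound-for : ∀ {n} k D E t → n ≡ Gadget.n k D E → k * k ≡ 3 * (5 * t) → 1 ≤ D → 1 ≤ E →
            2 * (2 * n * k) ≤ E * D → (A : StreamingAlgorithm n) → ComputesOPT A → ∀ m → IsMemory A m → t ≤ suc m
bound-for k D E t refl k*k≡15t 0<D 0<E large =
  gadget-memory-bound k D E t k*k≡15t (fromℕ< 0<E) (fromℕ< 0<D) large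

theorem6p1 : ∃ λ (C : ℕ) → ∃ λ (n₀ : ℕ) → 0 < C ×
    (∀ (n : ℕ) → n₀ ≤ n →
    (A : StreamingAlgorithm n) → ComputesOPT A →
    ∀ (m : ℕ) → IsMemory A m → n * n ≤ C * m)
theorem6p1 = 1320 * 1320 , 660 , s≤s z≤n , bound
  where
  bound : ∀ (n : ℕ) → 660 ≤ n → (A : StreamingAlgorithm n) → ComputesOPT A →
          ∀ (m : ℕ) → IsMemory A m → n * n ≤ 1320 * 1320 * m
  bound n 660≤n A computes m memory = begin
    n * n                        ≤⟨ *-mono-≤ n≤1320j n≤1320j ⟩
    1320 * j * (1320 * j)        ≡⟨ [m*n]*[o*p]≡[m*o]*[n*p] 1320 j 1320 j ⟩
    1320 * 1320 * (j * j)        ≤⟨ *-monoʳ-≤ (1320 * 1320) j*j≤m ⟩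
    1320 * 1320 * m              ∎
    where
    open ≤-Reasoning
    r j k D : ℕ
    r = n % 660
    j = n / 660
    -- Makes `k * k` equal to 15 times `15 * (j * j)`, the shape required for the number of INDEX
    -- bits.
    k = 15 * j
    -- Four blocks of Alice and two pad classes give `44 * k` vertices; the remainder `r` enlarges
    -- the class `padᵗ`. As `n` is at most `88 * k`, the pads are numerous enough because `4 * 88`
    -- is at most `20 * 20`.
    D = 20 * k
    n≡ : n ≡ r + 44 * k
    n≡ = trans (m≡m%n+[m/n]*n n 660) (cong (r +_) (trans (*-comm j 660) (*-assoc 44 15 j)))
    1≤j : 1 ≤ j
    1≤j = m≥n⇒m/n>0 660≤n
    r≤44k : r ≤ 44 * k
    r≤44k = begin
      r          ≤⟨ <⇒≤ (m%n<n n 660) ⟩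
      660 * 1    ≤⟨ *-monoʳ-≤ 660 1≤j ⟩
      660 * j    ≡⟨ *-assoc 44 15 j ⟩
      44 * k     ∎
    n≤88k : n ≤ 88 * k
    n≤88k = begin
      n                ≡⟨ n≡ ⟩
      r + 44 * k       ≤⟨ +-monoˡ-≤ (44 * k) r≤44k ⟩
      44 * k + 44 * k  ≡⟨ *-distribʳ-+ k 44 44 ⟨
      88 * k           ∎
    n≤1320j : n ≤ 1320 * j
    n≤1320j = ≤-trans n≤88k (≤-reflexive (sym (*-assoc 88 15 j)))
    1≤D : 1 ≤ D
    1≤D = *-mono-≤ (s≤s {n = 19} z≤n) (*-mono-≤ (s≤s {n = 14} z≤n) 1≤j)
    layout : ∀ k r → r + 44 * k ≡ k + (k + (k + (k + (20 * k + (20 * k + r)))))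
    layout = solve-∀
    square : ∀ j → 15 * j * (15 * j) ≡ 3 * (5 * (15 * (j * j)))
    square = solve-∀
    large : 2 * (2 * n * k) ≤ (D + r) * D
    large = begin
      2 * (2 * n * k)           ≤⟨ *-monoʳ-≤ 2 (*-monoˡ-≤ k (*-monoʳ-≤ 2 n≤88k)) ⟩
      2 * (2 * (88 * k) * k)    ≡⟨ regroup 88 k ⟩
      4 * 88 * (k * k)          ≤⟨ *-monoˡ-≤ (k * k) (≤ᵇ⇒≤ (4 * 88) (20 * 20) _) ⟩
      20 * 20 * (k * k)         ≡⟨ [m*n]*[o*p]≡[m*o]*[n*p] 20 20 k k ⟩
      D * D                     ≤⟨ *-monoˡ-≤ D (m≤m+n D r) ⟩
      (D + r) * D               ∎
      where
      regroup : ∀ c k → 2 * (2 * (c * k) * k) ≡ 4 * c * (k * k)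
      regroup = solve-∀
    15j*j≤1+m : 15 * (j * j) ≤ suc m
    15j*j≤1+m = bound-for k D (D + r) (15 * (j * j)) (trans n≡ (layout k r)) (square j)
      1≤D (≤-trans 1≤D (m≤m+n D r)) large A computes m memory
    j*j≤m : j * j ≤ m
    -- Since `j` is at least 1, one of the fifteen copies of `j * j` absorbs the 1 in `suc m`.
    j*j≤m = s≤s⁻¹ (≤-trans (+-mono-≤ (*-mono-≤ 1≤j 1≤j) (m≤m+n (j * j) (13 * (j * j)))) 15j*j≤1+m)
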